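{- Let $p$ be a prime. If there exists a counterexample to the $p$-adic Littlewood conjecture, then there exists a counterexample $x\in[0,1]$ to the $p$-adic Littlewood conjecture whose base-$p$ expansion is uniformly recurrent.
   Context: A real number $x$ satisfies the $p$-adic Littlewood conjecture (pLC) if $\liminf_{q\to\infty} q\cdot|q|_p\cdot\|qx\|=0$, where $q$ runs over the positive integers, $|\cdot|_p$ is the $p$-adic absolute value and $\|\cdot\|$ is the distance to the nearest integer. A counterexample to pLC is a real number that does not satisfy pLC (rational numbers always satisfy pLC, so counterexamples are irrational). For irrational $x\in[0,1]$, the base-$p$ expansion of $x$ is the unique infinite word $a_1a_2a_3\cdots$ on $\{0,1,\dots,p-1\}$ with $x=\sum_{i\ge1}a_ip^{ -i}$. An infinite word $w$ is uniformly recurrent if for every finite subword (block of consecutive letters) $v$ of $w$ there exists a constant $N_v$ such that $v$ appears in every subword of $w$ of length $N_v$. -}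

module Defs where

open import Data.Bool.Base using (if_then_else_)
open import Data.Fin.Base using (Fin; toℕ)
open import Data.Integer.Base as ℤ using (ℤ; +_)
import Data.Integer.DivMod as ℤ
import Data.Integer.Properties as ℤ
open import Data.List.Base using (List; length; applyUpTo)
open import Data.List.Relation.Binary.Infix.Heterogeneous using (Infix)
open import Data.Nat.Base as ℕ using (ℕ; zero; suc; NonZero)
import Data.Nat.Properties as ℕ
open import Data.Nat.Divisibility using (_∣?_)
open import Data.Product.Base using (∃; _×_; _,_)
open import Data.Rational.Base as ℚ using (ℚ; mkℚ; 0ℚ; 1ℚ)
import Data.Rational.Properties as ℚ
import Algebra.Properties.Group ℚ.+-0-group as ℚ+
import Data.Rational.Unnormalised.Base as ℚᵘ
import Data.Rational.Unnormalised.Properties as ℚᵘ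
open import Data.Rational.Solver using (module +-*-Solver)
open import Data.Sum.Base using (inj₁; inj₂)
open import Function.Base using (_∘_)
open import Relation.Binary.PropositionalEquality
  using (_≡_; refl; sym; trans; cong; subst; subst₂)
open import Relation.Nullary.Decidable.Core using (does)
open import Relation.Nullary.Negation.Core using (¬_)

ι : ℤ → ℚ
ι m = m ℚ./ 1

neg-involutive : ∀ p → ℚ.- ℚ.- p ≡ p
neg-involutive = ℚ+.⁻¹-involutive

ι-mono : ∀ {m n} → m ℤ.≤ n → ι m ℚ.≤ ι n
ι-mono {m} {n} m≤n = ℚ.toℚᵘ-cancel-≤ (begin
  ℚ.toℚᵘ (ι m)  ≃⟨ ℚ.toℚᵘ-fromℚᵘ (ℚᵘ.mkℚᵘ m 0) ⟩
  ℚᵘ.mkℚᵘ m 0   ≤⟨ ℚᵘ.*≤* (ℤ.*-monoʳ-≤-nonNeg (+ 1) m≤n) ⟩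
  ℚᵘ.mkℚᵘ n 0   ≃⟨ ℚ.toℚᵘ-fromℚᵘ (ℚᵘ.mkℚᵘ n 0) ⟨
  ℚ.toℚᵘ (ι n)  ∎)
  where open ℚᵘ.≤-Reasoning

ι-neg : ∀ m → ι (ℤ.- m) ≡ ℚ.- ι m
ι-neg (+ zero)     = refl
ι-neg (+ suc n)    = refl
ι-neg ℤ.-[1+ n ]   = sym (neg-involutive (ι (+ suc n)))

⌊r⌋≤r : ∀ r → ι (ℚ.floor r) ℚ.≤ r
⌊r⌋≤r r@(mkℚ n d _) = ℚ.toℚᵘ-cancel-≤ (begin
  ℚ.toℚᵘ (ι f)  ≃⟨ ℚ.toℚᵘ-fromℚᵘ (ℚᵘ.mkℚᵘ f 0) ⟩
  ℚᵘ.mkℚᵘ f 0   ≤⟨ ℚᵘ.*≤* (ℤ.≤-trans (ℤ.[n/d]*d≤n n (+ suc d))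
                             (ℤ.≤-reflexive (sym (ℤ.*-identityʳ n)))) ⟩
  ℚᵘ.mkℚᵘ n d   ∎)
  where
  open ℚᵘ.≤-Reasoning
  f = ℚ.floor r

≤⌊⌋ : ∀ m r → ι m ℚ.≤ r → m ℤ.≤ ℚ.floor r
≤⌊⌋ m r@(mkℚ n d _) m≤r = ℤ.≮⇒≥ λ f<m →
  ℤ.<-irrefl refl (ℤ.<-≤-trans n<[1+f]*d (ℤ.≤-trans
    (ℤ.*-monoʳ-≤-nonNeg (+ suc d) (ℤ.i<j⇒suc[i]≤j f<m)) m*d≤n))
  where
  n<[1+f]*d : n ℤ.< ℤ.suc (ℚ.floor r) ℤ.* + suc d
  n<[1+f]*d = subst (λ z → n ℤ.< ℤ.suc z ℤ.* + suc d)
                (sym (ℤ.div-pos-is-/ℕ n (suc d))) (ℤ.n<s[n/ℕd]*d n (suc d))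
  m*d≤n : m ℤ.* + suc d ℤ.≤ n
  m*d≤n = subst (m ℤ.* + suc d ℤ.≤_) (ℤ.*-identityʳ n)
    (ℚᵘ.drop-*≤* (ℚᵘ.≤-respˡ-≃ (ℚ.toℚᵘ-fromℚᵘ (ℚᵘ.mkℚᵘ m 0)) (ℚ.toℚᵘ-mono-≤ m≤r)))

⌈⌉≡-⌊-⌋ : ∀ r → ℚ.ceiling r ≡ ℤ.- ℚ.floor (ℚ.- r)
⌈⌉≡-⌊-⌋ (mkℚ _ _ _) = refl

-swap-≤ : ∀ {p q} → p ℚ.≤ ℚ.- q → q ℚ.≤ ℚ.- p
-swap-≤ {p} {q} h = subst (ℚ._≤ ℚ.- p) (neg-involutive q) (ℚ.neg-antimono-≤ h)

r≤⌈r⌉ : ∀ r → r ℚ.≤ ι (ℚ.ceiling r)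
r≤⌈r⌉ r = subst (r ℚ.≤_) (sym (trans (cong ι (⌈⌉≡-⌊-⌋ r)) (ι-neg (ℚ.floor (ℚ.- r)))))
            (-swap-≤ (⌊r⌋≤r (ℚ.- r)))

⌈⌉≤ : ∀ m r → r ℚ.≤ ι m → ℚ.ceiling r ℤ.≤ m
⌈⌉≤ m r r≤m = subst₂ ℤ._≤_ (sym (⌈⌉≡-⌊-⌋ r)) (ℤ.neg-involutive m)
  (ℤ.neg-mono-≤ (≤⌊⌋ (ℤ.- m) (ℚ.- r)
    (subst (ℚ._≤ ℚ.- r) (sym (ι-neg m)) (ℚ.neg-antimono-≤ r≤m))))

p≤∣p∣ : ∀ p → p ℚ.≤ ℚ.∣ p ∣
p≤∣p∣ p with ℚ.≤-total 0ℚ p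
... | inj₁ 0≤p = ℚ.≤-reflexive (sym (ℚ.0≤p⇒∣p∣≡p 0≤p))
... | inj₂ p≤0 = ℚ.≤-trans p≤0 (ℚ.0≤∣p∣ p)

-p≤∣p∣ : ∀ p → ℚ.- p ℚ.≤ ℚ.∣ p ∣
-p≤∣p∣ p = subst (ℚ.- p ℚ.≤_) (ℚ.∣-p∣≡∣p∣ p) (p≤∣p∣ (ℚ.- p))

-‿flip : ∀ p q → ℚ.- (p ℚ.- q) ≡ q ℚ.- p
-‿flip = solve 2 (λ p q → :- (p :- q) := q :- p) refl
  where open +-*-Solver

∣-∣-comm : ∀ p q → ℚ.∣ p ℚ.- q ∣ ≡ ℚ.∣ q ℚ.- p ∣
∣-∣-comm p q = trans (sym (ℚ.∣-p∣≡∣p∣ (p ℚ.- q))) (cong ℚ.∣_∣ (-‿flip p q))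

∣∣-bound : ∀ {p q} → p ℚ.≤ q → ℚ.- p ℚ.≤ q → ℚ.∣ p ∣ ℚ.≤ q
∣∣-bound {p} {q} h₁ h₂ with ℚ.∣p∣≡p∨∣p∣≡-p p
... | inj₁ e = subst (ℚ._≤ q) (sym e) h₁
... | inj₂ e = subst (ℚ._≤ q) (sym e) h₂

p≤q⇒0≤q-p : ∀ {p q} → p ℚ.≤ q → 0ℚ ℚ.≤ q ℚ.- p
p≤q⇒0≤q-p {p} {q} p≤q =
  subst (ℚ._≤ q ℚ.- p) (ℚ.+-inverseʳ p) (ℚ.+-monoˡ-≤ (ℚ.- p) p≤q)

triangle : ∀ p q r → ℚ.∣ p ℚ.- r ∣ ℚ.≤ ℚ.∣ p ℚ.- q ∣ ℚ.+ ℚ.∣ q ℚ.- r ∣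
triangle p q r = subst (λ z → ℚ.∣ z ∣ ℚ.≤ ℚ.∣ p ℚ.- q ∣ ℚ.+ ℚ.∣ q ℚ.- r ∣) (split p q r)
                   (ℚ.∣p+q∣≤∣p∣+∣q∣ (p ℚ.- q) (q ℚ.- r))
  where
  open +-*-Solver
  split : ∀ p q r → (p ℚ.- q) ℚ.+ (q ℚ.- r) ≡ p ℚ.- r
  split = solve 3 (λ p q r → (p :- q) :+ (q :- r) := p :- r) refl

≤+⇒-≤ : ∀ {p q r} → p ℚ.≤ q ℚ.+ r → p ℚ.- r ℚ.≤ q
≤+⇒-≤ {p} {q} {r} h = subst (p ℚ.- r ℚ.≤_) (cancel q r) (ℚ.+-monoˡ-≤ (ℚ.- r) h)
  where
  open +-*-Solver
  cancel : ∀ q r → (q ℚ.+ r) ℚ.- r ≡ q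
  cancel = solve 2 (λ q r → (q :+ r) :- r := q) refl

NonExpansive : (ℚ → ℚ) → Set
NonExpansive f = ∀ r s → ℚ.∣ f r ℚ.- f s ∣ ℚ.≤ ℚ.∣ r ℚ.- s ∣

nonExpansive : ∀ {f} → (∀ r s → f r ℚ.≤ ℚ.∣ r ℚ.- s ∣ ℚ.+ f s) → NonExpansive f
nonExpansive {f} h r s = ∣∣-bound (≤+⇒-≤ (h r s))
  (subst₂ ℚ._≤_ (sym (-‿flip (f r) (f s))) (∣-∣-comm s r) (≤+⇒-≤ (h s r)))

∣∣-nonExpansive : NonExpansive ℚ.∣_∣
∣∣-nonExpansive = nonExpansive λ r s →
  subst (λ z → ℚ.∣ z ∣ ℚ.≤ ℚ.∣ r ℚ.- s ∣ ℚ.+ ℚ.∣ s ∣) (split r s) (ℚ.∣p+q∣≤∣p∣+∣q∣ (r ℚ.- s) s)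
  where
  open +-*-Solver
  split : ∀ r s → (r ℚ.- s) ℚ.+ s ≡ r
  split = solve 2 (λ r s → (r :- s) :+ s := r) refl

-- Distance from a rational to the nearest integer.
‖_‖ℚ : ℚ → ℚ
‖ r ‖ℚ = (r ℚ.- ι (ℚ.floor r)) ℚ.⊓ (ι (ℚ.ceiling r) ℚ.- r)

‖‖ℚ-lower : ∀ r m → ‖ r ‖ℚ ℚ.≤ ℚ.∣ r ℚ.- ι m ∣
‖‖ℚ-lower r m with ℚ.≤-total (ι m) r
... | inj₁ m≤r = ℚ.≤-trans (ℚ.p⊓q≤p _ (ι (ℚ.ceiling r) ℚ.- r)) (ℚ.≤-trans
        (ℚ.+-monoʳ-≤ r (ℚ.neg-antimono-≤ (ι-mono (≤⌊⌋ m r m≤r)))) (p≤∣p∣ _))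
... | inj₂ r≤m = ℚ.≤-trans (ℚ.p⊓q≤q (r ℚ.- ι (ℚ.floor r)) _) (ℚ.≤-trans
        (ℚ.+-monoˡ-≤ (ℚ.- r) (ι-mono (⌈⌉≤ m r r≤m)))
        (subst (ℚ._≤ ℚ.∣ r ℚ.- ι m ∣) (-‿flip r (ι m)) (-p≤∣p∣ (r ℚ.- ι m))))

‖‖ℚ-attained : ∀ r → ∃ λ m → ‖ r ‖ℚ ≡ ℚ.∣ r ℚ.- ι m ∣
‖‖ℚ-attained r with ℚ.⊓-sel (r ℚ.- ι (ℚ.floor r)) (ι (ℚ.ceiling r) ℚ.- r)
... | inj₁ e = ℚ.floor r , trans e (sym (ℚ.0≤p⇒∣p∣≡p (p≤q⇒0≤q-p (⌊r⌋≤r r))))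
... | inj₂ e = ℚ.ceiling r , trans e (trans
        (sym (ℚ.0≤p⇒∣p∣≡p (p≤q⇒0≤q-p (r≤⌈r⌉ r)))) (∣-∣-comm (ι (ℚ.ceiling r)) r))

‖‖ℚ-nonExpansive : NonExpansive ‖_‖ℚ
‖‖ℚ-nonExpansive = nonExpansive bound
  where
  bound : ∀ r s → ‖ r ‖ℚ ℚ.≤ ℚ.∣ r ℚ.- s ∣ ℚ.+ ‖ s ‖ℚ
  bound r s with m , e ← ‖‖ℚ-attained s rewrite e =
    ℚ.≤-trans (‖‖ℚ-lower r m) (triangle r s (ι m))

------------------------------------------------------------------------
-- Real numbers, as Cauchy sequences of rationals. Two sequences denote
-- the same real when each is ≤ the other.

record ℝ : Set where
  constructor mkℝ
  field
    seq    : ℕ → ℚ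
    cauchy : ∀ ε → 0ℚ ℚ.< ε → ∃ λ N → ∀ m n → N ℕ.≤ m → N ℕ.≤ n →
             ℚ.∣ seq m ℚ.- seq n ∣ ℚ.< ε

open ℝ public

infix 4 _≤_ _<_
infixl 6 _-_
infixr 7 _•_

_≤_ : ℝ → ℝ → Set
x ≤ y = ∀ ε → 0ℚ ℚ.< ε → ∃ λ N → ∀ n → N ℕ.≤ n → seq x n ℚ.≤ seq y n ℚ.+ ε

_<_ : ℝ → ℝ → Set
x < y = ∃ λ ε → 0ℚ ℚ.< ε × ∃ λ N → ∀ n → N ℕ.≤ n → seq x n ℚ.+ ε ℚ.≤ seq y n

fromℚ : ℚ → ℝ
fromℚ r = mkℝ (λ _ → r) λ ε 0<ε → 0 , λ _ _ _ _ →
  subst (ℚ._< ε) (cong ℚ.∣_∣ (sym (ℚ.+-inverseʳ r))) 0<ε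

0ℝ 1ℝ : ℝ
0ℝ = fromℚ 0ℚ
1ℝ = fromℚ 1ℚ

half : ∀ ε → 0ℚ ℚ.< ε → 0ℚ ℚ.< ℚ.½ ℚ.* ε
half ε 0<ε = subst (ℚ._< ℚ.½ ℚ.* ε) (ℚ.*-zeroʳ ℚ.½) (ℚ.*-monoʳ-<-pos ℚ.½ 0<ε)

half+half : ∀ ε → ℚ.½ ℚ.* ε ℚ.+ ℚ.½ ℚ.* ε ≡ ε
half+half ε = trans (sym (ℚ.*-distribʳ-+ ε ℚ.½ ℚ.½)) (ℚ.*-identityˡ ε)

_-_ : ℝ → ℝ → ℝ
seq    (x - y) n = seq x n ℚ.- seq y n
cauchy (x - y) ε 0<ε
  with M , hx ← cauchy x (ℚ.½ ℚ.* ε) (half ε 0<ε)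
     | N , hy ← cauchy y (ℚ.½ ℚ.* ε) (half ε 0<ε)
  = M ℕ.⊔ N , λ m n M⊔N≤m M⊔N≤n →
    subst₂ (λ u v → ℚ.∣ u ∣ ℚ.< v) (swap (seq x m) (seq x n) (seq y m) (seq y n)) (half+half ε)
      (ℚ.≤-<-trans (ℚ.∣p-q∣≤∣p∣+∣q∣ (seq x m ℚ.- seq x n) (seq y m ℚ.- seq y n))
        (ℚ.+-mono-<
          (hx m n (ℕ.≤-trans (ℕ.m≤m⊔n M N) M⊔N≤m) (ℕ.≤-trans (ℕ.m≤m⊔n M N) M⊔N≤n))
          (hy m n (ℕ.≤-trans (ℕ.m≤n⊔m M N) M⊔N≤m) (ℕ.≤-trans (ℕ.m≤n⊔m M N) M⊔N≤n))))
  where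
  open +-*-Solver
  swap : ∀ a b c d → (a ℚ.- b) ℚ.- (c ℚ.- d) ≡ (a ℚ.- c) ℚ.- (b ℚ.- d)
  swap = solve 4 (λ a b c d → (a :- b) :- (c :- d) := (a :- c) :- (b :- d)) refl

_•_ : ℚ → ℝ → ℝ
seq    (r • x) n = r ℚ.* seq x n
cauchy (r • x) ε 0<ε = let N , h = cauchy x (ε ℚ.* ℚ.1/ K) 0<ε/K in
  N , λ m n N≤m N≤n → ℚ.≤-<-trans (scaled (seq x m) (seq x n))
      (subst (K ℚ.* ℚ.∣ seq x m ℚ.- seq x n ∣ ℚ.<_) K*ε/K≡ε
        (ℚ.*-monoʳ-<-pos K (h m n N≤m N≤n)))
  where
  K : ℚ
  K = 1ℚ ℚ.+ ℚ.∣ r ∣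
  0<K : 0ℚ ℚ.< K
  0<K = ℚ.<-≤-trans (ℚ.positive⁻¹ 1ℚ)
          (subst (ℚ._≤ K) (ℚ.+-identityʳ 1ℚ) (ℚ.+-monoʳ-≤ 1ℚ (ℚ.0≤∣p∣ r)))
  instance
    K-pos : ℚ.Positive K
    K-pos = ℚ.positive 0<K
    K-nonZero : ℚ.NonZero K
    K-nonZero = ℚ.pos⇒nonZero K
    1/K-pos : ℚ.Positive (ℚ.1/ K)
    1/K-pos = ℚ.1/pos⇒pos K
  0<ε/K : 0ℚ ℚ.< ε ℚ.* ℚ.1/ K
  0<ε/K = subst (ℚ._< ε ℚ.* ℚ.1/ K) (ℚ.*-zeroˡ (ℚ.1/ K)) (ℚ.*-monoˡ-<-pos (ℚ.1/ K) 0<ε)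
  K*ε/K≡ε : K ℚ.* (ε ℚ.* ℚ.1/ K) ≡ ε
  K*ε/K≡ε = trans (ℚ.*-comm K _) (trans (ℚ.*-assoc ε (ℚ.1/ K) K)
              (trans (cong (ε ℚ.*_) (ℚ.*-inverseˡ K)) (ℚ.*-identityʳ ε)))
  scaled : ∀ a b → ℚ.∣ r ℚ.* a ℚ.- r ℚ.* b ∣ ℚ.≤ K ℚ.* ℚ.∣ a ℚ.- b ∣
  scaled a b = subst (ℚ._≤ K ℚ.* ℚ.∣ a ℚ.- b ∣)
    (trans (sym (ℚ.∣p*q∣≡∣p∣*∣q∣ r (a ℚ.- b))) (cong ℚ.∣_∣ (factor a b)))
    (ℚ.*-monoʳ-≤-nonNeg ℚ.∣ a ℚ.- b ∣ {{ℚ.∣-∣-nonNeg (a ℚ.- b)}}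
      (subst (ℚ._≤ K) (ℚ.+-identityˡ ℚ.∣ r ∣) (ℚ.+-monoˡ-≤ ℚ.∣ r ∣ (ℚ.nonNegative⁻¹ 1ℚ))))
    where
    open +-*-Solver
    factor : ∀ a b → r ℚ.* (a ℚ.- b) ≡ r ℚ.* a ℚ.- r ℚ.* b
    factor a b = solve 3 (λ r a b → r :* (a :- b) := r :* a :- r :* b) refl r a b

lift : (f : ℚ → ℚ) → NonExpansive f → ℝ → ℝ
seq    (lift f _ x) n = f (seq x n)
cauchy (lift f f-ne x) ε 0<ε with N , h ← cauchy x ε 0<ε
  = N , λ m n N≤m N≤n → ℚ.≤-<-trans (f-ne (seq x m) (seq x n)) (h m n N≤m N≤n)

∣_∣ : ℝ → ℝ
∣_∣ = lift ℚ.∣_∣ ∣∣-nonExpansive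

-- Distance to the nearest integer: the continuous extension to ℝ of the
-- 1-Lipschitz function ‖_‖ℚ.
‖_‖ : ℝ → ℝ
‖_‖ = lift ‖_‖ℚ ‖‖ℚ-nonExpansive

infix 4 _⟶_

_⟶_ : (ℕ → ℝ) → ℝ → Set
u ⟶ l = ∀ ε → 0ℚ ℚ.< ε → ∃ λ N → ∀ n → N ℕ.≤ n → ∣ u n - l ∣ < fromℚ ε

-- v is the infimum of { u k ∣ n ≤ k }.
IsTailInfimum : (ℕ → ℝ) → ℕ → ℝ → Set
IsTailInfimum u n v =
  (∀ k → n ℕ.≤ k → v ≤ u k) ×
  (∀ w → (∀ k → n ℕ.≤ k → w ≤ u k) → w ≤ v)

IsLimInf : (ℕ → ℝ) → ℝ → Set
IsLimInf u l = ∃ λ (v : ℕ → ℝ) → (∀ n → IsTailInfimum u n (v n)) × v ⟶ l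

------------------------------------------------------------------------
-- The p-adic Littlewood conjecture

module _ (p : ℕ) where

  greatest : ℕ → ℕ → ℕ
  greatest q zero    = zero
  greatest q (suc k) = if does (p ℕ.^ suc k ∣? q) then suc k else greatest q k

  -- The greatest k ≤ q with p ^ k ∣ q. If p ≥ 2 and q ≥ 1, then p ^ k ∣ q
  -- forces k < q, so this is the p-adic valuation.
  valuation : ℕ → ℕ
  valuation q = greatest q q

  module _ .{{_ : NonZero p}} where

    p^- : ℕ → ℚ
    p^- k = (+ 1 ℚ./ (p ℕ.^ k)) {{ℕ.m^n≢0 p k}}

    -- The p-adic absolute value of a positive integer.
    ∣_∣ₚ : ℕ → ℚ
    ∣ q ∣ₚ = p^- (valuation q)

    -- The sequence q · |q|ₚ · ‖qx‖ over q = 1, 2, 3, …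
    pLC-sequence : ℝ → ℕ → ℝ
    pLC-sequence x n = (ι (+ q) ℚ.* ∣ q ∣ₚ) • ‖ ι (+ q) • x ‖
      where q = suc n

    PLC : ℝ → Set
    PLC x = IsLimInf (pLC-sequence x) 0ℝ

    Counterexample : ℝ → Set
    Counterexample x = ¬ PLC x

    -- Here a k is the digit of index k + 1 in the usual numbering.
    digitSum : (ℕ → Fin p) → ℕ → ℚ
    digitSum a zero    = 0ℚ
    digitSum a (suc n) = digitSum a n ℚ.+ ι (+ toℕ (a n)) ℚ.* p^- (suc n)

    -- x = ∑_{i ≥ 1} aᵢ p⁻ⁱ. For irrational x there is exactly one such a.
    IsExpansion : (ℕ → Fin p) → ℝ → Set
    IsExpansion a x = (fromℚ ∘ digitSum a) ⟶ x

------------------------------------------------------------------------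
-- Infinite words

module _ {A : Set} where

  block : (ℕ → A) → ℕ → ℕ → List A
  block w i n = applyUpTo (λ k → w (i ℕ.+ k)) n

  IsSubword : List A → (ℕ → A) → Set
  IsSubword v w = ∃ λ i → v ≡ block w i (length v)

  UniformlyRecurrent : (ℕ → A) → Set
  UniformlyRecurrent w = ∀ v → IsSubword v w →
    ∃ λ N → ∀ u → IsSubword u w → length u ≡ N → Infix _≡_ v u

{-# OPTIONS --safe #-}
-- If x is a counterexample, then q |q|ₚ ‖qx‖ ≥ c > 0 for all large q. Since
-- multiplying q by pⁿ does not change q |q|ₚ, all shifts pⁿx with n large
-- satisfy q |q|ₚ ‖q pⁿx‖ ≥ c for every q ≥ 1, and so does, up to halving c,
-- every limit of such shifts modulo 1. The words that approximate a shift form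
-- a language closed under subwords; thinning it to a minimal infinite
-- sublanguage and following an infinite branch there gives a uniformly
-- recurrent word, and the number with these digits is such a limit.
module Submission where

open import Defs
open import Axiom.DoubleNegationElimination using (em⇒dne)
open import Axiom.ExcludedMiddle using (ExcludedMiddle)
open import Data.Empty using (⊥-elim)
open import Data.Fin.Base as Fin using (Fin; toℕ)
import Data.Fin.Properties as Fin
open import Data.Integer.Base as ℤ using (ℤ; +_)
import Data.Integer.DivMod as ℤ
import Data.Integer.Properties as ℤ
import Data.Integer.Tactic.RingSolver as ℤSolver
open import Data.List.Base using (List; []; _∷_; _++_; _∷ʳ_; length; applyUpTo)
import Data.List.Properties as List
open import Data.List.Relation.Binary.Infix.Heterogeneous as Infix using (Infix)
import Data.List.Relation.Binary.Infix.Heterogeneous.Properties as Infix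
open import Data.List.Relation.Binary.Pointwise as Pointwise using (Pointwise-≡⇒≡)
open import Data.Nat.Base as ℕ using (ℕ; zero; suc; NonZero; s≤s; z≤n)
open import Data.Nat.DivMod as ℕ using (_mod_)
open import Data.Nat.Divisibility as ℕ using (_∣_; _∣?_; divides-refl)
open import Data.Nat.Primality using (Prime; prime⇒nonTrivial)
import Data.Nat.Properties as ℕ
import Data.Nat.Tactic.RingSolver as ℕSolver
open import Data.Product.Base using (∃; Σ; ∃₂; _×_; _,_; proj₁; proj₂)
open import Data.Rational.Base as ℚ using (ℚ; 0ℚ; 1ℚ; ½)
import Data.Rational.Properties as ℚ
open import Data.Rational.Solver using (module +-*-Solver)
import Data.Rational.Unnormalised.Base as ℚᵘ
import Data.Rational.Unnormalised.Properties as ℚᵘ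
open import Data.Sum.Base using (inj₁; inj₂)
open import Function.Base using (_∘_)
open import Level using (0ℓ)
open import Relation.Binary.PropositionalEquality
open import Relation.Nullary using (¬_; yes; no)

-- Uniformly recurrent words

-- Membership in the language is an inequality with slack, not an equality of digit blocks: because
-- of carries, digits are not stable under small errors, whereas an error of at most 2 units in the
-- last place survives the passage to subwords. For fixed `q` and a shift `y`, an approximation of
-- `y` by `j` digits changes `q |q|ₚ ‖q y‖` by at most a multiple of `p⁻ʲ`, so any part of `c` can
-- pay for it; the choice is one half. Minimality yields recurrence as follows. A word that occurs
-- in the limit was not forbidden at its turn, so the words of that stage that miss it have bounded
-- length; since all subwords of the limit belong to that stage, the gaps between occurrences are
-- bounded. Only the stage of the given word matters, which is why one pass through an enumeration
-- of all words can take the place of Zorn's lemma.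

infix 4 _⊑_

_⊑_ : {A : Set} → List A → List A → Set
_⊑_ = Infix _≡_

module _ {A : Set} where

  ⊑-trans : {t u v : List A} → t ⊑ u → u ⊑ v → t ⊑ v
  ⊑-trans = Infix.trans trans

  ⊑-view : {u v : List A} → u ⊑ v → ∃₂ λ s t → v ≡ s ++ u ++ t
  ⊑-view u⊑v with Infix.MkView s u≋ t ← Infix.toView u⊑v
    rewrite Pointwise-≡⇒≡ u≋ = s , t , refl

  ⊑-++ˡ : (s u : List A) → u ⊑ s ++ u
  ⊑-++ˡ s u = s Infix.++ⁱ Infix.fromPointwise (Pointwise.refl refl)

  ⊑-++ʳ : (u t : List A) → u ⊑ u ++ t
  ⊑-++ʳ u t = Infix.fromPointwise (Pointwise.refl refl) Infix.ⁱ++ t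

  applyUpTo-+ : (f : ℕ → A) (m n : ℕ) →
    applyUpTo f (m ℕ.+ n) ≡ applyUpTo f m ++ applyUpTo (f ∘ (m ℕ.+_)) n
  applyUpTo-+ f zero    n = refl
  applyUpTo-+ f (suc m) n = cong (f 0 ∷_) (applyUpTo-+ (f ∘ suc) m n)

  block⊑prefix : (w : ℕ → A) (i n : ℕ) → block w i n ⊑ applyUpTo w (i ℕ.+ n)
  block⊑prefix w i n rewrite applyUpTo-+ w i n = ⊑-++ˡ (applyUpTo w i) (block w i n)

Fin-bounded : ∀ {n} (f : Fin n → ℕ) → ∃ λ b → ∀ a → f a ℕ.≤ b
Fin-bounded {zero}  f = 0 , λ ()
Fin-bounded {suc n} f with b , h ← Fin-bounded (f ∘ Fin.suc) =
  f Fin.zero ℕ.⊔ b , λ where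
    Fin.zero    → ℕ.m≤m⊔n (f Fin.zero) b
    (Fin.suc a) → ℕ.≤-trans (h a) (ℕ.m≤n⊔m (f Fin.zero) b)

-- Enumeration of finite words and the minimal sublanguage

module Words (p : ℕ) .{{_ : NonZero p}} where

  decode : ℕ → ℕ → List (Fin p)
  decode zero    _       = []
  decode (suc f) zero    = []
  decode (suc f) (suc n) = n mod p ∷ decode f (n ℕ./ p)

  -- Bijective base-`p` numeration: the letter `a` counts as the digit `a + 1`, the first letter
  -- being the least significant. Ordinary base `p` would not see trailing letters 0.
  encode : List (Fin p) → ℕ
  encode []      = 0
  encode (a ∷ u) = suc (toℕ a ℕ.+ encode u ℕ.* p)

  -- The first argument of decode is fuel; a word is never longer than its code.
  word : ℕ → List (Fin p)
  word n = decode n n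

  length≤encode : ∀ u → length u ℕ.≤ encode u
  length≤encode []      = z≤n
  length≤encode (a ∷ u) = s≤s (ℕ.≤-trans (length≤encode u)
    (ℕ.≤-trans (ℕ.m≤m*n (encode u) p) (ℕ.m≤n+m _ (toℕ a))))

  decode-encode : ∀ f u → length u ℕ.≤ f → decode f (encode u) ≡ u
  decode-encode zero    []      _       = refl
  decode-encode (suc f) []      _       = refl
  decode-encode (suc f) (a ∷ u) (s≤s h) = cong₂ _∷_
    (Fin.toℕ-injective (trans (Fin.toℕ-fromℕ< _) (trans
      (ℕ.[m+kn]%n≡m%n (toℕ a) (encode u) p) (ℕ.m<n⇒m%n≡m (Fin.toℕ<n a)))))
    (trans (cong (decode f) quotient) (decode-encode f u h))
    where
    quotient : (toℕ a ℕ.+ encode u ℕ.* p) ℕ./ p ≡ encode u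
    quotient = trans (ℕ.+-distrib-/-∣ʳ (toℕ a) (divides-refl (encode u)))
      (cong₂ ℕ._+_ (ℕ.m<n⇒m/n≡0 (Fin.toℕ<n a)) (ℕ.m*n/n≡m (encode u) p))

  word-surjective : ∀ u → word (encode u) ≡ u
  word-surjective u = decode-encode (encode u) u (length≤encode u)

  Unbounded : (List (Fin p) → Set) → Set
  Unbounded L = ∀ n → ∃ λ v → n ℕ.≤ length v × L v

  InfixClosed : (List (Fin p) → Set) → Set
  InfixClosed L = ∀ {u v} → u ⊑ v → L v → L u

  module Minimal (em : ExcludedMiddle 0ℓ) (L : List (Fin p) → Set)
                 (closed : InfixClosed L) (unbounded : Unbounded L) where

    dne = em⇒dne em

    -- Greedily forbid the words one at a time, as long as arbitrarily long
    -- words remain. The languages decrease to a minimal one.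
    thin : ℕ → List (Fin p) → Set
    Avoidable : ℕ → Set
    thin zero    v = L v
    thin (suc k) v = thin k v × (Avoidable k → ¬ word k ⊑ v)
    Avoidable k = Unbounded λ v → thin k v × ¬ word k ⊑ v

    thin-closed : ∀ k → InfixClosed (thin k)
    thin-closed zero    u⊑v h       = closed u⊑v h
    thin-closed (suc k) u⊑v (h , g) =
      thin-closed k u⊑v h , λ av w⊑u → g av (⊑-trans w⊑u u⊑v)

    thin-unbounded : ∀ k → Unbounded (thin k)
    thin-unbounded zero      = unbounded
    thin-unbounded (suc k) n with em {Avoidable k}
    ... | yes av = let v , n≤ , h , ¬w⊑v = av n in v , n≤ , h , λ _ → ¬w⊑v
    ... | no ¬av = let v , n≤ , h = thin-unbounded k n in v , n≤ , h , ⊥-elim ∘ ¬av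

    thin-antitone : ∀ {k l} → k ℕ.≤ l → ∀ {v} → thin l v → thin k v
    thin-antitone k≤l = go (ℕ.≤⇒≤′ k≤l)
      where
      go : ∀ {k l} → k ℕ.≤′ l → ∀ {v} → thin l v → thin k v
      go ℕ.≤′-refl       h       = h
      go (ℕ.≤′-step k≤l) (h , _) = go k≤l h

    -- A single `n` bounds the length and names the stage. As the stages decrease, this already
    -- gives extensions of any length in any stage.
    Extendable : List (Fin p) → Set
    Extendable u = ∀ n → ∃ λ v → n ℕ.≤ length v × thin n (u ++ v)

    -- Pigeonhole on the finite alphabet: if every letter failed at some `n`, an extension taken
    -- past all these failures would begin with a letter that did not fail. In `suc b` the extra 1
    -- is for that letter.
    extend : ∀ {u} → Extendable u → ∃ λ a → Extendable (u ∷ʳ a)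
    extend {u} ext = dne λ none →
      let bad : ∀ a → ∃ λ n → ¬ ∃ λ v → n ℕ.≤ length v × thin n ((u ∷ʳ a) ++ v)
          bad a = dne λ ok → none (a , λ n → dne λ ¬v → ok (n , ¬v))
          b , bound = Fin-bounded (proj₁ ∘ bad)
      in contra bad b bound (ext (suc b))
      where
      contra : (bad : ∀ a → ∃ λ n → ¬ ∃ λ v → n ℕ.≤ length v × thin n ((u ∷ʳ a) ++ v)) →
               ∀ b → (∀ a → proj₁ (bad a) ℕ.≤ b) →
               ¬ ∃ λ v → suc b ℕ.≤ length v × thin (suc b) (u ++ v)
      contra bad b bound (a ∷ v , s≤s b≤ , h) = proj₂ (bad a)
        (v , ℕ.≤-trans (bound a) b≤ ,
         thin-antitone (ℕ.m≤n⇒m≤1+n (bound a))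
           (subst (thin (suc b)) (sym (List.∷ʳ-++ u a v)) h))

    prefixes : ℕ → Σ (List (Fin p)) Extendable
    prefixes zero    = [] , λ n → thin-unbounded n n
    prefixes (suc n) = let u , ext = prefixes n ; a , ext′ = extend ext in u ∷ʳ a , ext′

    limit : ℕ → Fin p
    limit n = proj₁ (extend (proj₂ (prefixes n)))

    prefix-limit : ∀ n → applyUpTo limit n ≡ proj₁ (prefixes n)
    prefix-limit zero    = refl
    prefix-limit (suc n) = trans (sym (List.applyUpTo-∷ʳ limit n))
      (cong (_∷ʳ limit n) (prefix-limit n))

    -- A subword of `limit` lies in some prefix, and each prefix extends to a word of any given
    -- stage; closure under subwords does the rest.
    thin-limit : ∀ k {u} → IsSubword u limit → thin k u
    thin-limit k {u} (i , u≡) with v , _ , h ← proj₂ (prefixes (i ℕ.+ length u)) k =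
      thin-closed k (⊑-trans
        (subst₂ _⊑_ (sym u≡) (prefix-limit (i ℕ.+ length u)) (block⊑prefix limit i (length u)))
        (⊑-++ʳ _ v)) h

    limit-recurrent : UniformlyRecurrent limit
    limit-recurrent v v∈ = subst (λ v → ∃ λ N → ∀ u → IsSubword u limit → length u ≡ N → v ⊑ u)
      (word-surjective v) (let N , h = bound in N , λ u u∈ len → dne λ ¬v⊑u →
        h (u , ℕ.≤-reflexive (sym len) , thin-limit k u∈ , ¬v⊑u))
      where
      k = encode v
      unavoidable : ¬ Avoidable k
      -- `v` lies in stage `suc k`, where `word k` would be forbidden if it were avoidable; but
      -- `word k` is `v` itself.
      unavoidable av = proj₂ (thin-limit (suc k) v∈) av
        (subst (_⊑ v) (sym (word-surjective v)) (⊑-++ˡ [] v))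
      bound : ∃ λ N → ¬ ∃ λ u → N ℕ.≤ length u × thin k u × ¬ word k ⊑ u
      bound = dne λ none → unavoidable λ n → dne λ ¬u → none (n , ¬u)

    prefix∈L : ∀ n → L (applyUpTo limit n)
    prefix∈L n = thin-limit 0 (0 , cong (applyUpTo limit) (sym (List.length-applyUpTo limit n)))

-- Rational and real estimates

ι-+ : ∀ m n → ι (m ℤ.+ n) ≡ ι m ℚ.+ ι n
ι-+ m n = ℚ.toℚᵘ-injective (begin-equality
  ℚ.toℚᵘ (ι (m ℤ.+ n))              ≃⟨ ℚ.toℚᵘ-fromℚᵘ (ℚᵘ.mkℚᵘ (m ℤ.+ n) 0) ⟩
  ℚᵘ.mkℚᵘ (m ℤ.+ n) 0               ≃⟨ ℚᵘ.*≡* (cong (ℤ._* + 1)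
                                         (cong₂ ℤ._+_ (sym (ℤ.*-identityʳ m)) (sym (ℤ.*-identityʳ n)))) ⟩
  ℚᵘ.mkℚᵘ m 0 ℚᵘ.+ ℚᵘ.mkℚᵘ n 0      ≃⟨ ℚᵘ.+-cong (ℚ.toℚᵘ-fromℚᵘ (ℚᵘ.mkℚᵘ m 0)) (ℚ.toℚᵘ-fromℚᵘ (ℚᵘ.mkℚᵘ n 0)) ⟨
  ℚ.toℚᵘ (ι m) ℚᵘ.+ ℚ.toℚᵘ (ι n)    ≃⟨ ℚ.toℚᵘ-homo-+ (ι m) (ι n) ⟨
  ℚ.toℚᵘ (ι m ℚ.+ ι n)              ∎)
  where open ℚᵘ.≤-Reasoning

ι-* : ∀ m n → ι (m ℤ.* n) ≡ ι m ℚ.* ι n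
ι-* m n = ℚ.toℚᵘ-injective (begin-equality
  ℚ.toℚᵘ (ι (m ℤ.* n))              ≃⟨ ℚ.toℚᵘ-fromℚᵘ (ℚᵘ.mkℚᵘ (m ℤ.* n) 0) ⟩
  ℚᵘ.mkℚᵘ m 0 ℚᵘ.* ℚᵘ.mkℚᵘ n 0      ≃⟨ ℚᵘ.*-cong (ℚ.toℚᵘ-fromℚᵘ (ℚᵘ.mkℚᵘ m 0)) (ℚ.toℚᵘ-fromℚᵘ (ℚᵘ.mkℚᵘ n 0)) ⟨
  ℚ.toℚᵘ (ι m) ℚᵘ.* ℚ.toℚᵘ (ι n)    ≃⟨ ℚ.toℚᵘ-homo-* (ι m) (ι n) ⟨
  ℚ.toℚᵘ (ι m ℚ.* ι n)              ∎)
  where open ℚᵘ.≤-Reasoning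

ιℕ-* : ∀ m n → ι (+ (m ℕ.* n)) ≡ ι (+ m) ℚ.* ι (+ n)
ιℕ-* m n = trans (cong ι (ℤ.pos-* m n)) (ι-* (+ m) (+ n))

ιℕ-nonNeg : ∀ n → ℚ.NonNegative (ι (+ n))
ιℕ-nonNeg n = ℚ.nonNegative (ι-mono {+ 0} {+ n} (ℤ.+≤+ z≤n))

ιℕ-pos : ∀ n .{{_ : NonZero n}} → ℚ.Positive (ι (+ n))
ιℕ-pos (suc n) = ℚ.positive (ℚ.<-≤-trans (ℚ.positive⁻¹ 1ℚ) (ι-mono {+ 1} {+ suc n} (ℤ.+≤+ (s≤s z≤n))))

ι*1/ : ∀ n .{{_ : NonZero n}} → ι (+ n) ℚ.* (+ 1 ℚ./ n) ≡ 1ℚ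
ι*1/ (suc n) = ℚ.toℚᵘ-injective (begin-equality
  ℚ.toℚᵘ (ι (+ suc n) ℚ.* (+ 1 ℚ./ suc n))            ≃⟨ ℚ.toℚᵘ-homo-* (ι (+ suc n)) (+ 1 ℚ./ suc n) ⟩
  ℚ.toℚᵘ (ι (+ suc n)) ℚᵘ.* ℚ.toℚᵘ (+ 1 ℚ./ suc n)    ≃⟨ ℚᵘ.*-cong (ℚ.toℚᵘ-fromℚᵘ (ℚᵘ.mkℚᵘ (+ suc n) 0)) (ℚ.toℚᵘ-fromℚᵘ (ℚᵘ.mkℚᵘ (+ 1) n)) ⟩
  ℚᵘ.mkℚᵘ (+ suc n) 0 ℚᵘ.* ℚᵘ.mkℚᵘ (+ 1) n            ≃⟨ ℚᵘ.*-inverseʳ (ℚᵘ.mkℚᵘ (+ suc n) 0) ⟩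
  ℚᵘ.1ℚᵘ                                              ∎)
  where open ℚᵘ.≤-Reasoning

1/-pos : ∀ n .{{_ : NonZero n}} → ℚ.Positive (+ 1 ℚ./ n)
1/-pos n = ℚ.normalize-pos 1 n

∣∣-* : ∀ r s → .{{ℚ.NonNegative r}} → ℚ.∣ r ℚ.* s ∣ ≡ r ℚ.* ℚ.∣ s ∣
∣∣-* r s = trans (ℚ.∣p*q∣≡∣p∣*∣q∣ r s) (cong (ℚ._* ℚ.∣ s ∣) (ℚ.0≤p⇒∣p∣≡p (ℚ.nonNegative⁻¹ r)))

∣r-⌊r⌋∣≤1 : ∀ r → ℚ.∣ r ℚ.- ι (ℚ.floor r) ∣ ℚ.≤ 1ℚ
∣r-⌊r⌋∣≤1 r = subst (ℚ._≤ 1ℚ) (sym (ℚ.0≤p⇒∣p∣≡p (p≤q⇒0≤q-p (⌊r⌋≤r r))))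
  (≤+⇒-≤ (subst (r ℚ.≤_) (ι-+ (+ 1) f) (ℚ.<⇒≤ (ℚ.≰⇒> λ h →
    ℤ.<-irrefl refl (ℤ.<-≤-trans (ℤ.suc[i]≤j⇒i<j ℤ.≤-refl) (≤⌊⌋ (ℤ.suc f) r h))))))
  where f = ℚ.floor r

‖‖ℚ-nonNeg : ∀ r → 0ℚ ℚ.≤ ‖ r ‖ℚ
‖‖ℚ-nonNeg r with m , e ← ‖‖ℚ-attained r = subst (0ℚ ℚ.≤_) (sym e) (ℚ.0≤∣p∣ (r ℚ.- ι m))

-- If `M` is an integer nearest to `q t`, then `q m + M` is an integer to compare with `q s`. Thus
-- only the distance of `s` and `t` modulo 1 counts, magnified by `q`.
‖‖ℚ-shift : ∀ q m s t →
  ‖ ι (+ q) ℚ.* s ‖ℚ ℚ.≤ ι (+ q) ℚ.* ℚ.∣ s ℚ.- ι m ℚ.- t ∣ ℚ.+ ‖ ι (+ q) ℚ.* t ‖ℚ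
‖‖ℚ-shift q m s t with M , e ← ‖‖ℚ-attained (ι (+ q) ℚ.* t) = begin
  ‖ Q ℚ.* s ‖ℚ                                                    ≤⟨ ‖‖ℚ-lower (Q ℚ.* s) (+ q ℤ.* m ℤ.+ M) ⟩
  ℚ.∣ Q ℚ.* s ℚ.- ι (+ q ℤ.* m ℤ.+ M) ∣                           ≡⟨ cong (λ z → ℚ.∣ Q ℚ.* s ℚ.- z ∣) (trans (ι-+ (+ q ℤ.* m) M) (cong (ℚ._+ ι M) (ι-* (+ q) m))) ⟩
  ℚ.∣ Q ℚ.* s ℚ.- (Q ℚ.* ι m ℚ.+ ι M) ∣                           ≡⟨ cong ℚ.∣_∣ (split Q s t (ι m) (ι M)) ⟩
  ℚ.∣ Q ℚ.* (s ℚ.- ι m ℚ.- t) ℚ.+ (Q ℚ.* t ℚ.- ι M) ∣             ≤⟨ ℚ.∣p+q∣≤∣p∣+∣q∣ (Q ℚ.* (s ℚ.- ι m ℚ.- t)) (Q ℚ.* t ℚ.- ι M) ⟩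
  ℚ.∣ Q ℚ.* (s ℚ.- ι m ℚ.- t) ∣ ℚ.+ ℚ.∣ Q ℚ.* t ℚ.- ι M ∣         ≡⟨ cong₂ ℚ._+_ (∣∣-* Q _ {{ιℕ-nonNeg q}}) (sym e) ⟩
  Q ℚ.* ℚ.∣ s ℚ.- ι m ℚ.- t ∣ ℚ.+ ‖ Q ℚ.* t ‖ℚ                    ∎
  where
  open ℚ.≤-Reasoning
  open +-*-Solver
  Q = ι (+ q)
  split : ∀ Q s t a b → Q ℚ.* s ℚ.- (Q ℚ.* a ℚ.+ b) ≡ Q ℚ.* (s ℚ.- a ℚ.- t) ℚ.+ (Q ℚ.* t ℚ.- b)
  split = solve 5 (λ Q s t a b → Q :* s :- (Q :* a :+ b) := Q :* (s :- a :- t) :+ (Q :* t :- b)) refl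

p≤q+∣p-q∣ : ∀ p q → p ℚ.≤ q ℚ.+ ℚ.∣ p ℚ.- q ∣
p≤q+∣p-q∣ p q = subst (ℚ._≤ q ℚ.+ ℚ.∣ p ℚ.- q ∣) (cancel p q) (ℚ.+-monoʳ-≤ q (p≤∣p∣ (p ℚ.- q)))
  where
  open +-*-Solver
  cancel : ∀ p q → q ℚ.+ (p ℚ.- q) ≡ p
  cancel = solve 2 (λ p q → q :+ (p :- q) := p) refl

p-0≡p : ∀ p → p ℚ.- 0ℚ ≡ p
p-0≡p p = ℚ.+-identityʳ p

p<p+q : ∀ p {q} → 0ℚ ℚ.< q → p ℚ.< p ℚ.+ q
p<p+q p {q} 0<q = subst (ℚ._< p ℚ.+ q) (ℚ.+-identityʳ p) (ℚ.+-monoʳ-< p 0<q)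

-- Positive lower limits as rational lower bounds

Eventually : (ℕ → Set) → Set
Eventually P = ∃ λ N → ∀ n → N ℕ.≤ n → P n

module _ (u : ℕ → ℝ) where

  -- The inner threshold may depend on `n`: the terms `u n` are bounded as reals, with no uniformity
  -- in their approximations.
  BoundedBelow : ℚ → Set
  BoundedBelow c = Eventually λ n → Eventually λ m → c ℚ.≤ seq (u n) m

  -- The constant `c` is a lower bound of a late tail, hence lies below its infimum `v n`, which
  -- contradicts `v ⟶ 0ℝ`.
  bounded⇒liminf≢0 : ∀ {c} → 0ℚ ℚ.< c → BoundedBelow c → ¬ IsLimInf u 0ℝ
  bounded⇒liminf≢0 {c} 0<c (N , bound) (v , inf , v⟶0)
    with N₁ , near ← v⟶0 (½ ℚ.* c) (half c 0<c) = ℚ.<-irrefl refl absurd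
    where
    open ℚ.≤-Reasoning
    n = N ℕ.⊔ N₁
    c≤v : fromℚ c ≤ v n
    c≤v = proj₂ (inf n) (fromℚ c) λ k n≤k ε 0<ε →
      let M , h = bound k (ℕ.≤-trans (ℕ.m≤m⊔n N N₁) n≤k) in
      M , λ m M≤m → ℚ.≤-trans (h m M≤m)
        (ℚ.<⇒≤ (p<p+q (seq (u k) m) 0<ε))
    absurd : c ℚ.< c
    absurd with ε , 0<ε , M₁ , h₁ ← near n (ℕ.m≤n⊔m N N₁)
              | M₂ , h₂ ← c≤v (½ ℚ.* c) (half c 0<c) = begin-strict
      c                                          ≤⟨ h₂ m (ℕ.m≤n⊔m M₁ M₂) ⟩
      a ℚ.+ ½ ℚ.* c                              ≤⟨ ℚ.+-monoˡ-≤ (½ ℚ.* c) (p≤∣p∣ a) ⟩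
      ℚ.∣ a ∣ ℚ.+ ½ ℚ.* c                        ≡⟨ cong (λ z → ℚ.∣ z ∣ ℚ.+ ½ ℚ.* c) (sym (p-0≡p a)) ⟩
      ℚ.∣ a ℚ.- 0ℚ ∣ ℚ.+ ½ ℚ.* c                 <⟨ ℚ.+-monoˡ-< (½ ℚ.* c) (p<p+q ℚ.∣ a ℚ.- 0ℚ ∣ 0<ε) ⟩
      (ℚ.∣ a ℚ.- 0ℚ ∣ ℚ.+ ε) ℚ.+ ½ ℚ.* c         ≤⟨ ℚ.+-monoˡ-≤ (½ ℚ.* c) (h₁ m (ℕ.m≤m⊔n M₁ M₂)) ⟩
      ½ ℚ.* c ℚ.+ ½ ℚ.* c                        ≡⟨ half+half c ⟩
      c                                          ∎
      where
      m = M₁ ℕ.⊔ M₂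
      a = seq (v n) m

  -- If no positive `c` works, every tail of this nonnegative sequence has infimum 0, so the
  -- constant sequence `0ℝ` serves as the sequence of infima and none has to be constructed.
  liminf≢0⇒bounded : ExcludedMiddle 0ℓ → (∀ n m → 0ℚ ℚ.≤ seq (u n) m) →
    ¬ IsLimInf u 0ℝ → ∃ λ c → 0ℚ ℚ.< c × BoundedBelow c
  liminf≢0⇒bounded em u≥0 ¬lim = dne λ none →
    ¬lim ((λ _ → 0ℝ) , (λ n → lower n , greatest-lower none n) , converges)
    where
    dne = em⇒dne em
    lower : ∀ n k → n ℕ.≤ k → 0ℝ ≤ u k
    lower n k _ ε 0<ε = 0 , λ m _ →
      ℚ.≤-trans (u≥0 k m) (ℚ.<⇒≤ (p<p+q (seq (u k) m) 0<ε))
    converges : (λ _ → 0ℝ) ⟶ 0ℝ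
    converges ε 0<ε = 0 , λ _ _ → ε , 0<ε , 0 , λ _ _ → ℚ.≤-reflexive (ℚ.+-identityˡ ε)
    module _ (none : ¬ ∃ λ c → 0ℚ ℚ.< c × BoundedBelow c) where
      small : ∀ c → 0ℚ ℚ.< c → ∀ N → ∃ λ n → N ℕ.≤ n × ∀ M → ∃ λ m → M ℕ.≤ m × seq (u n) m ℚ.< c
      small c 0<c N = dne λ ¬n → none (c , 0<c , N , λ n N≤n → dne λ ¬M → ¬n (n , N≤n , λ M →
        dne λ ¬m → ¬M (M , λ m M≤m → ℚ.≮⇒≥ λ lt → ¬m (m , M≤m , lt))))
      greatest-lower : ∀ n w → (∀ k → n ℕ.≤ k → w ≤ u k) → w ≤ 0ℝ
      greatest-lower n w w≤u ε 0<ε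
        -- `h` gives small approximations of `u k` only at arbitrarily late indices; the Cauchy
        -- property spreads one of them to all late indices. A quarter of `ε` goes to the small
        -- value, a quarter to the oscillation, and half to the slack in `w ≤ u k`.
        with k , n≤k , h ← small (½ ℚ.* (½ ℚ.* ε)) (half _ (half ε 0<ε)) n
        with M , close ← cauchy (u k) (½ ℚ.* (½ ℚ.* ε)) (half _ (half ε 0<ε))
           | M′ , below ← w≤u k n≤k (½ ℚ.* ε) (half ε 0<ε)
        with m , M≤m , lt ← h M = M ℕ.⊔ M′ , λ i le → begin
          seq w i                                ≤⟨ below i (ℕ.≤-trans (ℕ.m≤n⊔m M M′) le) ⟩
          b i ℚ.+ e₁                             ≤⟨ ℚ.+-monoˡ-≤ e₁ (p≤q+∣p-q∣ (b i) (b m)) ⟩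
          (b m ℚ.+ ℚ.∣ b i ℚ.- b m ∣) ℚ.+ e₁     ≤⟨ ℚ.+-monoˡ-≤ e₁ (ℚ.+-mono-≤ (ℚ.<⇒≤ lt)
                                                     (ℚ.<⇒≤ (close i m (ℕ.≤-trans (ℕ.m≤m⊔n M M′) le) M≤m))) ⟩
          (½ ℚ.* e₁ ℚ.+ ½ ℚ.* e₁) ℚ.+ e₁         ≡⟨ cong (ℚ._+ e₁) (half+half e₁) ⟩
          e₁ ℚ.+ e₁                              ≡⟨ half+half ε ⟩
          ε                                      ≡⟨ ℚ.+-identityˡ ε ⟨
          0ℚ ℚ.+ ε                               ∎
        where
        open ℚ.≤-Reasoning
        e₁ = ½ ℚ.* ε
        b = seq (u k)

-- Powers of `p`, the valuation and the factor `q |q|ₚ`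

module _ (p : ℕ) .{{_ : NonZero p}} where

  p^-pos : ∀ k → ℚ.Positive (p^- p k)
  p^-pos k = 1/-pos (p ℕ.^ k) {{ℕ.m^n≢0 p k}}

  P : ℕ → ℚ
  P k = ι (+ (p ℕ.^ k))

  P-pos : ∀ k → ℚ.Positive (P k)
  P-pos k = ιℕ-pos (p ℕ.^ k) {{ℕ.m^n≢0 p k}}

  P-nonNeg : ∀ k → ℚ.NonNegative (P k)
  P-nonNeg k = ιℕ-nonNeg (p ℕ.^ k)

  P-+ : ∀ j k → P (j ℕ.+ k) ≡ P j ℚ.* P k
  P-+ j k = trans (cong (ι ∘ +_) (ℕ.^-distribˡ-+-* p j k)) (ιℕ-* (p ℕ.^ j) (p ℕ.^ k))

  P*p^- : ∀ k → P k ℚ.* p^- p k ≡ 1ℚ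
  P*p^- k = ι*1/ (p ℕ.^ k) {{ℕ.m^n≢0 p k}}

  p^-+ : ∀ j k → p^- p (j ℕ.+ k) ≡ p^- p j ℚ.* p^- p k
  p^-+ j k = begin
    a                                  ≡⟨ ℚ.*-identityʳ a ⟨
    a ℚ.* 1ℚ                           ≡⟨ cong (a ℚ.*_) (cong₂ ℚ._*_ (P*p^- j) (P*p^- k)) ⟨
    a ℚ.* ((P j ℚ.* b) ℚ.* (P k ℚ.* c)) ≡⟨ regroup a (P j) b (P k) c ⟩
    ((P j ℚ.* P k) ℚ.* a) ℚ.* (b ℚ.* c) ≡⟨ cong (λ z → (z ℚ.* a) ℚ.* (b ℚ.* c)) (P-+ j k) ⟨
    (P (j ℕ.+ k) ℚ.* a) ℚ.* (b ℚ.* c)  ≡⟨ cong (ℚ._* (b ℚ.* c)) (P*p^- (j ℕ.+ k)) ⟩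
    1ℚ ℚ.* (b ℚ.* c)                   ≡⟨ ℚ.*-identityˡ (b ℚ.* c) ⟩
    b ℚ.* c                            ∎
    where
    open ≡-Reasoning
    open +-*-Solver using (solve; _:=_; _:*_)
    a = p^- p (j ℕ.+ k)
    b = p^- p j
    c = p^- p k
    regroup : ∀ a x b y c → a ℚ.* ((x ℚ.* b) ℚ.* (y ℚ.* c)) ≡ ((x ℚ.* y) ℚ.* a) ℚ.* (b ℚ.* c)
    regroup = solve 5 (λ a x b y c → a :* ((x :* b) :* (y :* c)) := ((x :* y) :* a) :* (b :* c)) refl

  κ : ℕ → ℚ
  κ q = ι (+ q) ℚ.* ∣_∣ₚ p q

  κ-nonNeg : ∀ q → ℚ.NonNegative (κ q)
  κ-nonNeg q = ℚ.nonNeg*nonNeg⇒nonNeg (ι (+ q)) {{ιℕ-nonNeg q}}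
    (p^- p (valuation p q)) {{ℚ.pos⇒nonNeg (p^- p (valuation p q)) {{p^-pos (valuation p q)}}}}

  pLC-sequence-nonNeg : ∀ x n m → 0ℚ ℚ.≤ seq (pLC-sequence p x n) m
  pLC-sequence-nonNeg x n m = ℚ.nonNegative⁻¹ _ {{ℚ.nonNeg*nonNeg⇒nonNeg (κ (suc n)) {{κ-nonNeg (suc n)}}
    _ {{ℚ.nonNegative (‖‖ℚ-nonNeg (ι (+ suc n) ℚ.* seq x m))}}}}

  greatest-∣ : ∀ q k → p ℕ.^ greatest p q k ∣ q
  greatest-∣ q zero = ℕ.1∣ q
  greatest-∣ q (suc k) with p ℕ.^ suc k ∣? q
  ... | yes d = d
  ... | no  _ = greatest-∣ q k

  greatest-max : ∀ q k j → j ℕ.≤ k → p ℕ.^ j ∣ q → j ℕ.≤ greatest p q k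
  greatest-max q zero    j j≤k _ = j≤k
  greatest-max q (suc k) j j≤k d with p ℕ.^ suc k ∣? q
  ... | yes _ = j≤k
  ... | no ¬d with ℕ.m≤n⇒m<n∨m≡n j≤k
  ...   | inj₁ (s≤s j≤k′) = greatest-max q k j j≤k′ d
  ...   | inj₂ refl       = ⊥-elim (¬d d)

  module _ (1<p : 1 ℕ.< p) where

    n<p^n : ∀ n → n ℕ.< p ℕ.^ n
    n<p^n zero    = s≤s z≤n
    n<p^n (suc n) = ℕ.≤-<-trans (n<p^n n) (ℕ.^-monoʳ-< p 1<p (ℕ.n<1+n n))

    valuation-max : ∀ q .{{_ : NonZero q}} j → p ℕ.^ j ∣ q → j ℕ.≤ valuation p q
    valuation-max q j d = greatest-max q q j (ℕ.≤-trans (ℕ.<⇒≤ (n<p^n j)) (ℕ.∣⇒≤ d)) d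

    -- The upper bound cancels `p ^ n`: if `p ^ j` divides `q * p ^ n` and `n ≤ j`, then
    -- `p ^ (j ∸ n)` divides `q`.
    valuation-*^ : ∀ q .{{_ : NonZero q}} n → valuation p (q ℕ.* p ℕ.^ n) ≡ valuation p q ℕ.+ n
    valuation-*^ q {{q≢0}} n = ℕ.≤-antisym upper (valuation-max (q ℕ.* p ℕ.^ n) {{q*p^n≢0}} _
      (subst (_∣ q ℕ.* p ℕ.^ n) (sym (ℕ.^-distribˡ-+-* p v n)) (ℕ.*-monoˡ-∣ (p ℕ.^ n) (greatest-∣ q q))))
      where
      v = valuation p q
      j = valuation p (q ℕ.* p ℕ.^ n)
      q*p^n≢0 : NonZero (q ℕ.* p ℕ.^ n)
      q*p^n≢0 = ℕ.m*n≢0 q (p ℕ.^ n) {{q≢0}} {{ℕ.m^n≢0 p n}}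
      upper : j ℕ.≤ v ℕ.+ n
      upper with ℕ.≤-total j n
      ... | inj₁ j≤n = ℕ.≤-trans j≤n (ℕ.m≤n+m n v)
      ... | inj₂ n≤j = subst (ℕ._≤ v ℕ.+ n) (ℕ.m∸n+n≡m n≤j) (ℕ.+-monoˡ-≤ n
        (valuation-max q (j ℕ.∸ n) (ℕ.*-cancelʳ-∣ (p ℕ.^ n) {{ℕ.m^n≢0 p n}}
          (subst (_∣ q ℕ.* p ℕ.^ n)
            (trans (cong (p ℕ.^_) (sym (ℕ.m∸n+n≡m n≤j))) (ℕ.^-distribˡ-+-* p (j ℕ.∸ n) n))
            (greatest-∣ (q ℕ.* p ℕ.^ n) (q ℕ.* p ℕ.^ n))))))

    κ-*^ : ∀ q .{{_ : NonZero q}} n → κ (q ℕ.* p ℕ.^ n) ≡ κ q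
    κ-*^ q n = trans (cong₂ ℚ._*_ (ιℕ-* q (p ℕ.^ n))
        (trans (cong (p^- p) (valuation-*^ q n)) (p^-+ (valuation p q) n)))
      (trans (regroup (ι (+ q)) (P n) (p^- p (valuation p q)) (p^- p n))
        (trans (cong (κ q ℚ.*_) (P*p^- n)) (ℚ.*-identityʳ (κ q))))
      where
      open +-*-Solver
      regroup : ∀ a b c d → (a ℚ.* b) ℚ.* (c ℚ.* d) ≡ (a ℚ.* c) ℚ.* (b ℚ.* d)
      regroup = solve 4 (λ a b c d → (a :* b) :* (c :* d) := (a :* c) :* (b :* d)) refl

    -- Since `j < p ^ j`, any `j` at least `r / ε` will do; the absolute value of the ceiling turns
    -- this into a natural threshold.
    archimedean : ∀ r {ε} → 0ℚ ℚ.< ε → Eventually λ j → r ℚ.≤ ε ℚ.* P j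
    archimedean r {ε} 0<ε = ℤ.∣ c ∣ , λ j c≤j → begin
      r                            ≡⟨ ℚ.*-identityˡ r ⟨
      1ℚ ℚ.* r                     ≡⟨ cong (ℚ._* r) (ℚ.*-inverseʳ ε) ⟨
      (ε ℚ.* ℚ.1/ ε) ℚ.* r         ≡⟨ ℚ.*-assoc ε (ℚ.1/ ε) r ⟩
      ε ℚ.* (ℚ.1/ ε ℚ.* r)         ≤⟨ ℚ.*-monoˡ-≤-nonNeg ε (r≤⌈r⌉ (ℚ.1/ ε ℚ.* r)) ⟩
      ε ℚ.* ι c                    ≤⟨ ℚ.*-monoˡ-≤-nonNeg ε (ι-mono {c} {+ (p ℕ.^ j)} (ℤ.≤-trans (i≤∣i∣ c)
                                        (ℤ.+≤+ (ℕ.≤-trans c≤j (ℕ.<⇒≤ (n<p^n j)))))) ⟩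
      ε ℚ.* P j                    ∎
      where
      open ℚ.≤-Reasoning
      instance
        ε-pos : ℚ.Positive ε
        ε-pos = ℚ.positive 0<ε
        ε-nonNeg : ℚ.NonNegative ε
        ε-nonNeg = ℚ.pos⇒nonNeg ε
        ε≢0 : ℚ.NonZero ε
        ε≢0 = ℚ.pos⇒nonZero ε
      c = ℚ.ceiling (ℚ.1/ ε ℚ.* r)
      i≤∣i∣ : ∀ i → i ℤ.≤ + ℤ.∣ i ∣
      i≤∣i∣ (+ n)        = ℤ.≤-refl
      i≤∣i∣ (ℤ.-[1+ n ]) = ℤ.-≤+

-- Words approximating the shifts of a real number

2ℚ : ℚ
2ℚ = 1ℚ ℚ.+ 1ℚ

module _ (p : ℕ) .{{_ : NonZero p}} where

  open Words p

  value : List (Fin p) → ℕ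
  value []      = 0
  value (a ∷ v) = toℕ a ℕ.* p ℕ.^ length v ℕ.+ value v

  value-++ : ∀ u v → value (u ++ v) ≡ value u ℕ.* p ℕ.^ length v ℕ.+ value v
  value-++ []      v = refl
  value-++ (a ∷ u) v = trans
    (cong₂ (λ e n → toℕ a ℕ.* e ℕ.+ n)
      (trans (cong (p ℕ.^_) (List.length-++ u)) (ℕ.^-distribˡ-+-* p (length u) (length v)))
      (value-++ u v))
    (regroup (toℕ a) (p ℕ.^ length u) (p ℕ.^ length v) (value u) (value v))
    where
    regroup : ∀ a x y m n → a ℕ.* (x ℕ.* y) ℕ.+ (m ℕ.* y ℕ.+ n) ≡ (a ℕ.* x ℕ.+ m) ℕ.* y ℕ.+ n
    regroup = ℕSolver.solve-∀

  value-∷ʳ : ∀ u a → value (u ∷ʳ a) ≡ value u ℕ.* p ℕ.+ toℕ a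
  value-∷ʳ u a = trans (value-++ u (a ∷ [])) (cong₂ (λ x y → value u ℕ.* x ℕ.+ y)
    (ℕ.*-identityʳ p) (trans (ℕ.+-identityʳ _) (ℕ.*-identityʳ (toℕ a))))

  value<p^length : ∀ v → value v ℕ.< p ℕ.^ length v
  value<p^length []      = s≤s z≤n
  value<p^length (a ∷ v) = ℕ.<-≤-trans
    (ℕ.+-monoʳ-< (toℕ a ℕ.* p ℕ.^ length v) (value<p^length v))
    (ℕ.≤-trans (ℕ.≤-reflexive (ℕ.+-comm (toℕ a ℕ.* p ℕ.^ length v) (p ℕ.^ length v)))
      (ℕ.*-monoˡ-≤ (p ℕ.^ length v) (Fin.toℕ<n a)))

  -- Division of the quotient `m` by `p` produces the next digit, placed in front. Remainders are
  -- nonnegative, so negative `M` need no separate case.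
  lastDigits : ∀ l M → ∃₂ λ m v → length v ≡ l × M ≡ m ℤ.* + (p ℕ.^ l) ℤ.+ + value v
  lastDigits zero    M = M , [] , refl , sym (trans (ℤ.+-identityʳ (M ℤ.* + 1)) (ℤ.*-identityʳ M))
  lastDigits (suc l) M with m , v , refl , e ← lastDigits l M =
    m ℤ./ℕ p , a ∷ v , refl , (begin
      M                                                         ≡⟨ e ⟩
      m ℤ.* X ℤ.+ + value v                                     ≡⟨ cong (λ z → z ℤ.* X ℤ.+ + value v) (ℤ.a≡a%ℕn+[a/ℕn]*n m p) ⟩
      (+ (m ℤ.%ℕ p) ℤ.+ (m ℤ./ℕ p) ℤ.* + p) ℤ.* X ℤ.+ + value v ≡⟨ cong (λ z → (+ z ℤ.+ (m ℤ./ℕ p) ℤ.* + p) ℤ.* X ℤ.+ + value v) (Fin.toℕ-fromℕ< _) ⟨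
      (+ toℕ a ℤ.+ (m ℤ./ℕ p) ℤ.* + p) ℤ.* X ℤ.+ + value v      ≡⟨ regroup (+ toℕ a) (m ℤ./ℕ p) (+ p) X (+ value v) ⟩
      (m ℤ./ℕ p) ℤ.* (+ p ℤ.* X) ℤ.+ (+ toℕ a ℤ.* X ℤ.+ + value v)
        ≡⟨ cong₂ (λ y z → (m ℤ./ℕ p) ℤ.* y ℤ.+ (z ℤ.+ + value v)) (ℤ.pos-* p (p ℕ.^ length v)) (ℤ.pos-* (toℕ a) (p ℕ.^ length v)) ⟨
      (m ℤ./ℕ p) ℤ.* + (p ℕ.^ suc (length v)) ℤ.+ + value (a ∷ v) ∎)
    where
    open ≡-Reasoning
    X = + (p ℕ.^ length v)
    a = Fin.fromℕ< (ℤ.n%ℕd<d m p)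
    regroup : ∀ a m p x n → (a ℤ.+ m ℤ.* p) ℤ.* x ℤ.+ n ≡ m ℤ.* (p ℤ.* x) ℤ.+ (a ℤ.* x ℤ.+ n)
    regroup = ℤSolver.solve-∀

  offset-value-++ : ∀ m u v → m ℤ.* + (p ℕ.^ length (u ++ v)) ℤ.+ + value (u ++ v) ≡
    (m ℤ.* + (p ℕ.^ length u) ℤ.+ + value u) ℤ.* + (p ℕ.^ length v) ℤ.+ + value v
  offset-value-++ m u v = begin
    m ℤ.* + (p ℕ.^ length (u ++ v)) ℤ.+ + value (u ++ v)
      ≡⟨ cong₂ (λ y z → m ℤ.* + y ℤ.+ + z)
           (trans (cong (p ℕ.^_) (List.length-++ u)) (ℕ.^-distribˡ-+-* p (length u) (length v))) (value-++ u v) ⟩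
    m ℤ.* + (U ℕ.* V) ℤ.+ (+ (value u ℕ.* V) ℤ.+ + value v)
      ≡⟨ cong₂ (λ y z → m ℤ.* y ℤ.+ (z ℤ.+ + value v)) (ℤ.pos-* U V) (ℤ.pos-* (value u) V) ⟩
    m ℤ.* (+ U ℤ.* + V) ℤ.+ (+ value u ℤ.* + V ℤ.+ + value v)
      ≡⟨ regroup m (+ U) (+ V) (+ value u) (+ value v) ⟩
    (m ℤ.* + U ℤ.+ + value u) ℤ.* + V ℤ.+ + value v ∎
    where
    open ≡-Reasoning
    U = p ℕ.^ length u
    V = p ℕ.^ length v
    regroup : ∀ m x y a b → m ℤ.* (x ℤ.* y) ℤ.+ (a ℤ.* y ℤ.+ b) ≡ (m ℤ.* x ℤ.+ a) ℤ.* y ℤ.+ b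
    regroup = ℤSolver.solve-∀

  -- With N the value of a word v of length l, this is |pⁿx − (m + 0.v)| ≤ 2 p⁻ˡ,
  -- multiplied by pˡ to make the approximating number an integer.
  Near : ℝ → ℕ → ℕ → ℕ → ℤ → Set
  Near x n l N m = Eventually λ k → ℚ.∣ P p (n ℕ.+ l) ℚ.* seq x k ℚ.- ι (m ℤ.* + (p ℕ.^ l) ℤ.+ + N) ∣ ℚ.≤ 2ℚ

  -- Shift `n` and integer part `m` may vary from word to word, so no convergent subsequence of
  -- shifts has to be chosen.
  ShiftLanguage : ℝ → ℕ → List (Fin p) → Set
  ShiftLanguage x n₀ v = ∃ λ n → n₀ ℕ.≤ n × ∃ λ m → Near x n (length v) (value v) m

  -- A further shift by the length of `u` moves the digits `u` into the integer part and leaves the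
  -- inequality itself unchanged.
  dropˡ : ∀ x n₀ u v → ShiftLanguage x n₀ (u ++ v) → ShiftLanguage x n₀ v
  dropˡ x n₀ u v (n , n₀≤n , m , K , h) =
    n ℕ.+ length u , ℕ.m≤n⇒m≤n+o (length u) n₀≤n , m ℤ.* + (p ℕ.^ length u) ℤ.+ + value u , K , λ k K≤k →
      subst₂ (λ j z → ℚ.∣ P p j ℚ.* seq x k ℚ.- ι z ∣ ℚ.≤ 2ℚ)
        (trans (cong (n ℕ.+_) (List.length-++ u)) (sym (ℕ.+-assoc n (length u) (length v))))
        (offset-value-++ m u v) (h k K≤k)

  -- In units of the last place of `u ++ v`, forgetting `v` adds at most `p ^ length v - 1` to the
  -- error 2, and the total is at most `2 * p ^ length v`, which is again 2 units in the last place
  -- of `u`.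
  dropʳ : ∀ x n₀ u v → ShiftLanguage x n₀ (u ++ v) → ShiftLanguage x n₀ u
  dropʳ x n₀ u v (n , n₀≤n , m , K , h) = n , n₀≤n , m , K , λ k K≤k →
    ℚ.*-cancelˡ-≤-pos V {{P-pos p (length v)}} (begin
      V ℚ.* ℚ.∣ A k ∣                                  ≡⟨ ∣∣-* V (A k) {{P-nonNeg p (length v)}} ⟨
      ℚ.∣ V ℚ.* A k ∣                                  ≡⟨ cong ℚ.∣_∣ (eq k) ⟩
      ℚ.∣ B k ℚ.+ ι (+ value v) ∣                        ≤⟨ ℚ.∣p+q∣≤∣p∣+∣q∣ (B k) (ι (+ value v)) ⟩
      ℚ.∣ B k ∣ ℚ.+ ℚ.∣ ι (+ value v) ∣                  ≤⟨ ℚ.+-mono-≤ (h k K≤k) (ℚ.≤-reflexive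
                                                            (ℚ.0≤p⇒∣p∣≡p (ℚ.nonNegative⁻¹ (ι (+ value v)) {{ιℕ-nonNeg (value v)}}))) ⟩
      2ℚ ℚ.+ ι (+ value v)                               ≡⟨ ℚ.+-assoc 1ℚ 1ℚ (ι (+ value v)) ⟩
      1ℚ ℚ.+ (1ℚ ℚ.+ ι (+ value v))                      ≡⟨ cong (1ℚ ℚ.+_) (ι-+ (+ 1) (+ value v)) ⟨
      1ℚ ℚ.+ ι (+ suc (value v))                         ≤⟨ ℚ.+-mono-≤ (ι-mono {+ 1} {+ (p ℕ.^ length v)} (ℤ.+≤+ (ℕ.m^n>0 p (length v))))
                                                            (ι-mono {+ suc (value v)} {+ (p ℕ.^ length v)} (ℤ.+≤+ (value<p^length v))) ⟩
      V ℚ.+ V                                          ≡⟨ double V ⟩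
      V ℚ.* 2ℚ                                         ∎)
    where
    open ℚ.≤-Reasoning
    open +-*-Solver
    V = P p (length v)
    M = m ℤ.* + (p ℕ.^ length u) ℤ.+ + value u
    A B : ℕ → ℚ
    A k = P p (n ℕ.+ length u) ℚ.* seq x k ℚ.- ι M
    B k = P p (n ℕ.+ length (u ++ v)) ℚ.* seq x k ℚ.- ι (m ℤ.* + (p ℕ.^ length (u ++ v)) ℤ.+ + value (u ++ v))
    double : ∀ r → r ℚ.+ r ≡ r ℚ.* 2ℚ
    double = solve 1 (λ r → r :+ r := r :* (con 1ℚ :+ con 1ℚ)) refl
    regroup : ∀ V Q s M N → V ℚ.* (Q ℚ.* s ℚ.- M) ≡ ((Q ℚ.* V) ℚ.* s ℚ.- (M ℚ.* V ℚ.+ N)) ℚ.+ N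
    regroup = solve 5 (λ V Q s M N → V :* (Q :* s :- M) := ((Q :* V) :* s :- (M :* V :+ N)) :+ N) refl
    eqP : P p (n ℕ.+ length (u ++ v)) ≡ P p (n ℕ.+ length u) ℚ.* V
    eqP = trans (cong (P p) (trans (cong (n ℕ.+_) (List.length-++ u)) (sym (ℕ.+-assoc n (length u) (length v)))))
      (P-+ p (n ℕ.+ length u) (length v))
    eqι : ι (m ℤ.* + (p ℕ.^ length (u ++ v)) ℤ.+ + value (u ++ v)) ≡ ι M ℚ.* V ℚ.+ ι (+ value v)
    eqι = trans (cong ι (offset-value-++ m u v))
      (trans (ι-+ (M ℤ.* + (p ℕ.^ length v)) (+ value v)) (cong (ℚ._+ ι (+ value v)) (ι-* M (+ (p ℕ.^ length v)))))
    eq : ∀ k → V ℚ.* A k ≡ B k ℚ.+ ι (+ value v)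
    eq k = trans (regroup V (P p (n ℕ.+ length u)) (seq x k) (ι M) (ι (+ value v)))
      (sym (cong₂ (λ Q z → (Q ℚ.* seq x k ℚ.- z) ℚ.+ ι (+ value v)) eqP eqι))

  shiftLanguage-closed : ∀ x n₀ → InfixClosed (ShiftLanguage x n₀)
  shiftLanguage-closed x n₀ {u} u⊑v h with s , t , refl ← ⊑-view u⊑v =
    dropʳ x n₀ u t (dropˡ x n₀ s (u ++ t) h)

  -- The shift `n₀` alone supplies words of every length. Taking the floor costs 1 and replacing `x`
  -- by the rational `seq x K` costs 1, whence the constant 2 in `Near`.
  shiftLanguage-unbounded : ∀ x n₀ → Unbounded (ShiftLanguage x n₀)
  shiftLanguage-unbounded x n₀ l
    with K , close ← cauchy x (p^- p (n₀ ℕ.+ l)) (ℚ.positive⁻¹ _ {{p^-pos p (n₀ ℕ.+ l)}})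
    with m , v , refl , e ← lastDigits l (ℚ.floor (P p (n₀ ℕ.+ l) ℚ.* seq x K))
    = v , ℕ.≤-refl , n₀ , ℕ.≤-refl , m , K , λ k K≤k → begin
      ℚ.∣ Q ℚ.* seq x k ℚ.- ι (m ℤ.* + (p ℕ.^ length v) ℤ.+ + value v) ∣   ≡⟨ cong (λ z → ℚ.∣ Q ℚ.* seq x k ℚ.- ι z ∣) e ⟨
      ℚ.∣ Q ℚ.* seq x k ℚ.- ι (ℚ.floor r) ∣                           ≤⟨ triangle (Q ℚ.* seq x k) r (ι (ℚ.floor r)) ⟩
      ℚ.∣ Q ℚ.* seq x k ℚ.- r ∣ ℚ.+ ℚ.∣ r ℚ.- ι (ℚ.floor r) ∣         ≤⟨ ℚ.+-mono-≤ (near k K≤k) (∣r-⌊r⌋∣≤1 r) ⟩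
      2ℚ                                                              ∎
    where
    open ℚ.≤-Reasoning
    open +-*-Solver
    Q = P p (n₀ ℕ.+ length v)
    r = Q ℚ.* seq x K
    factor : ∀ Q a b → Q ℚ.* a ℚ.- Q ℚ.* b ≡ Q ℚ.* (a ℚ.- b)
    factor = solve 3 (λ Q a b → Q :* a :- Q :* b := Q :* (a :- b)) refl
    near : ∀ k → K ℕ.≤ k → ℚ.∣ Q ℚ.* seq x k ℚ.- r ∣ ℚ.≤ 1ℚ
    near k K≤k = begin
      ℚ.∣ Q ℚ.* seq x k ℚ.- r ∣               ≡⟨ cong ℚ.∣_∣ (factor Q (seq x k) (seq x K)) ⟩
      ℚ.∣ Q ℚ.* (seq x k ℚ.- seq x K) ∣       ≡⟨ ∣∣-* Q _ {{P-nonNeg p (n₀ ℕ.+ length v)}} ⟩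
      Q ℚ.* ℚ.∣ seq x k ℚ.- seq x K ∣         ≤⟨ ℚ.*-monoˡ-≤-nonNeg Q {{P-nonNeg p (n₀ ℕ.+ length v)}} (ℚ.<⇒≤ (close k K K≤k ℕ.≤-refl)) ⟩
      Q ℚ.* p^- p (n₀ ℕ.+ length v)           ≡⟨ P*p^- p (n₀ ℕ.+ length v) ⟩
      1ℚ                                      ∎

  P*digitSum : ∀ a j → P p j ℚ.* digitSum p a j ≡ ι (+ value (applyUpTo a j))
  P*digitSum a zero    = refl
  P*digitSum a (suc j) = begin
    P p (suc j) ℚ.* (D ℚ.+ d ℚ.* p^- p (suc j))               ≡⟨ expand (P p (suc j)) D d (p^- p (suc j)) ⟩
    P p (suc j) ℚ.* D ℚ.+ d ℚ.* (P p (suc j) ℚ.* p^- p (suc j)) ≡⟨ cong₂ (λ y z → y ℚ.* D ℚ.+ d ℚ.* z) (ιℕ-* p (p ℕ.^ j)) (P*p^- p (suc j)) ⟩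
    (ι (+ p) ℚ.* P p j) ℚ.* D ℚ.+ d ℚ.* 1ℚ                    ≡⟨ regroup (ι (+ p)) (P p j) D d ⟩
    (P p j ℚ.* D) ℚ.* ι (+ p) ℚ.+ d                           ≡⟨ cong (λ z → z ℚ.* ι (+ p) ℚ.+ d) (P*digitSum a j) ⟩
    ι (+ value u) ℚ.* ι (+ p) ℚ.+ d                             ≡⟨ cong (ℚ._+ d) (ιℕ-* (value u) p) ⟨
    ι (+ (value u ℕ.* p)) ℚ.+ d                                 ≡⟨ ι-+ (+ (value u ℕ.* p)) (+ toℕ (a j)) ⟨
    ι (+ (value u ℕ.* p ℕ.+ toℕ (a j)))                         ≡⟨ cong (ι ∘ +_) (value-∷ʳ u (a j)) ⟨
    ι (+ value (u ∷ʳ a j))                                      ≡⟨ cong (ι ∘ +_ ∘ value) (List.applyUpTo-∷ʳ a j) ⟩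
    ι (+ value (applyUpTo a (suc j)))                           ∎
    where
    open ≡-Reasoning
    open +-*-Solver using (solve; _:=_; _:*_; _:+_; con)
    D = digitSum p a j
    d = ι (+ toℕ (a j))
    u = applyUpTo a j
    expand : ∀ x D d y → x ℚ.* (D ℚ.+ d ℚ.* y) ≡ x ℚ.* D ℚ.+ d ℚ.* (x ℚ.* y)
    expand = solve 4 (λ x D d y → x :* (D :+ d :* y) := x :* D :+ d :* (x :* y)) refl
    regroup : ∀ p x D d → (p ℚ.* x) ℚ.* D ℚ.+ d ℚ.* 1ℚ ≡ (x ℚ.* D) ℚ.* p ℚ.+ d
    regroup = solve 4 (λ p x D d → (p :* x) :* D :+ d :* con 1ℚ := (x :* D) :* p :+ d) refl

-- Real numbers with given digits

module _ (p : ℕ) .{{_ : NonZero p}} where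

  digitSum≥0 : ∀ a j → 0ℚ ℚ.≤ digitSum p a j
  digitSum≥0 a j = ℚ.*-cancelˡ-≤-pos (P p j) {{P-pos p j}}
    (subst₂ ℚ._≤_ (sym (ℚ.*-zeroʳ (P p j))) (sym (P*digitSum p a j))
      (ℚ.nonNegative⁻¹ _ {{ιℕ-nonNeg (value p (applyUpTo a j))}}))

  digitSum≤1 : ∀ a j → digitSum p a j ℚ.≤ 1ℚ
  digitSum≤1 a j = ℚ.*-cancelˡ-≤-pos (P p j) {{P-pos p j}}
    (subst₂ ℚ._≤_ (sym (P*digitSum p a j)) (sym (ℚ.*-identityʳ (P p j)))
      (ι-mono {+ value p u} {+ (p ℕ.^ j)} (ℤ.+≤+ (ℕ.≤-trans (ℕ.<⇒≤ (value<p^length p u))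
        (ℕ.≤-reflexive (cong (p ℕ.^_) (List.length-applyUpTo a j)))))))
    where u = applyUpTo a j

  -- Multiplied by `p ^ (j + d)`, the difference becomes the integer spelled by the `d` digits after
  -- place `j`, which is below `p ^ d`.
  digitSum-tail : ∀ a j d → P p j ℚ.* ℚ.∣ digitSum p a (j ℕ.+ d) ℚ.- digitSum p a j ∣ ℚ.≤ 1ℚ
  digitSum-tail a j d = ℚ.*-cancelˡ-≤-pos (P p d) {{P-pos p d}} (begin
    P p d ℚ.* (P p j ℚ.* ℚ.∣ D′ ℚ.- D ∣)            ≡⟨ assoc (P p d) (P p j) ℚ.∣ D′ ℚ.- D ∣ ⟩
    (P p j ℚ.* P p d) ℚ.* ℚ.∣ D′ ℚ.- D ∣            ≡⟨ cong (ℚ._* ℚ.∣ D′ ℚ.- D ∣) (P-+ p j d) ⟨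
    P p (j ℕ.+ d) ℚ.* ℚ.∣ D′ ℚ.- D ∣                ≡⟨ ∣∣-* (P p (j ℕ.+ d)) (D′ ℚ.- D) {{P-nonNeg p (j ℕ.+ d)}} ⟨
    ℚ.∣ P p (j ℕ.+ d) ℚ.* (D′ ℚ.- D) ∣              ≡⟨ cong ℚ.∣_∣ tail ⟩
    ℚ.∣ ι (+ value p v) ∣                             ≡⟨ ℚ.0≤p⇒∣p∣≡p (ℚ.nonNegative⁻¹ _ {{ιℕ-nonNeg (value p v)}}) ⟩
    ι (+ value p v)                                   ≤⟨ ι-mono {+ value p v} {+ (p ℕ.^ d)} (ℤ.+≤+ (ℕ.≤-trans (ℕ.<⇒≤ (value<p^length p v))
                                                         (ℕ.≤-reflexive (cong (p ℕ.^_) (List.length-applyUpTo _ d))))) ⟩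
    P p d                                           ≡⟨ ℚ.*-identityʳ (P p d) ⟨
    P p d ℚ.* 1ℚ                                    ∎)
    where
    open ℚ.≤-Reasoning
    open +-*-Solver
    D′ = digitSum p a (j ℕ.+ d)
    D = digitSum p a j
    u = applyUpTo a j
    v = applyUpTo (a ∘ (j ℕ.+_)) d
    assoc : ∀ x y z → x ℚ.* (y ℚ.* z) ≡ (y ℚ.* x) ℚ.* z
    assoc = solve 3 (λ x y z → x :* (y :* z) := (y :* x) :* z) refl
    distrib : ∀ x y z D → (y ℚ.* x) ℚ.* (z ℚ.- D) ≡ (y ℚ.* x) ℚ.* z ℚ.- (y ℚ.* D) ℚ.* x
    distrib = solve 4 (λ x y z D → (y :* x) :* (z :- D) := (y :* x) :* z :- (y :* D) :* x) refl
    cancel : ∀ x y → (x ℚ.+ y) ℚ.- x ≡ y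
    cancel = solve 2 (λ x y → (x :+ y) :- x := y) refl
    tail : P p (j ℕ.+ d) ℚ.* (D′ ℚ.- D) ≡ ι (+ value p v)
    tail = begin-equality
      P p (j ℕ.+ d) ℚ.* (D′ ℚ.- D)                               ≡⟨ cong (ℚ._* (D′ ℚ.- D)) (P-+ p j d) ⟩
      (P p j ℚ.* P p d) ℚ.* (D′ ℚ.- D)                           ≡⟨ distrib (P p d) (P p j) D′ D ⟩
      (P p j ℚ.* P p d) ℚ.* D′ ℚ.- (P p j ℚ.* D) ℚ.* P p d       ≡⟨ cong₂ (λ y z → y ℚ.* D′ ℚ.- z ℚ.* P p d) (sym (P-+ p j d)) (P*digitSum p a j) ⟩
      P p (j ℕ.+ d) ℚ.* D′ ℚ.- ι (+ value p u) ℚ.* P p d           ≡⟨ cong₂ ℚ._-_ (trans (P*digitSum p a (j ℕ.+ d)) (cong (ι ∘ +_ ∘ value p) (applyUpTo-+ a j d)))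
                                                                      (sym (ιℕ-* (value p u) (p ℕ.^ d))) ⟩
      ι (+ value p (u ++ v)) ℚ.- ι (+ (value p u ℕ.* p ℕ.^ d))       ≡⟨ cong (λ n → ι (+ n) ℚ.- ι (+ (value p u ℕ.* p ℕ.^ d)))
                                                                      (trans (value-++ p u v) (cong (λ l → value p u ℕ.* p ℕ.^ l ℕ.+ value p v) (List.length-applyUpTo _ d))) ⟩
      ι (+ (value p u ℕ.* p ℕ.^ d ℕ.+ value p v)) ℚ.- ι (+ (value p u ℕ.* p ℕ.^ d))
                                                                 ≡⟨ cong (ℚ._- ι (+ (value p u ℕ.* p ℕ.^ d))) (ι-+ (+ (value p u ℕ.* p ℕ.^ d)) (+ value p v)) ⟩
      (ι (+ (value p u ℕ.* p ℕ.^ d)) ℚ.+ ι (+ value p v)) ℚ.- ι (+ (value p u ℕ.* p ℕ.^ d))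
                                                                 ≡⟨ cancel (ι (+ (value p u ℕ.* p ℕ.^ d))) (ι (+ value p v)) ⟩
      ι (+ value p v)                                              ∎

  module _ (1<p : 1 ℕ.< p) where

    digitSum-cauchy : ∀ a ε → 0ℚ ℚ.< ε → ∃ λ N → ∀ m n → N ℕ.≤ m → N ℕ.≤ n →
      ℚ.∣ digitSum p a m ℚ.- digitSum p a n ∣ ℚ.< ε
    -- The two tails after place `J` cost 1 each; the third unit makes the inequality strict.
    digitSum-cauchy a ε 0<ε with J , arch ← archimedean p 1<p (1ℚ ℚ.+ 2ℚ) 0<ε =
      J , λ m n J≤m J≤n → ℚ.*-cancelˡ-<-nonNeg (P p J) {{P-nonNeg p J}} (begin-strict
        P p J ℚ.* ℚ.∣ S m ℚ.- S n ∣                                          ≤⟨ ℚ.*-monoˡ-≤-nonNeg (P p J) {{P-nonNeg p J}} (triangle (S m) (S J) (S n)) ⟩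
        P p J ℚ.* (ℚ.∣ S m ℚ.- S J ∣ ℚ.+ ℚ.∣ S J ℚ.- S n ∣)                  ≡⟨ ℚ.*-distribˡ-+ (P p J) ℚ.∣ S m ℚ.- S J ∣ ℚ.∣ S J ℚ.- S n ∣ ⟩
        P p J ℚ.* ℚ.∣ S m ℚ.- S J ∣ ℚ.+ P p J ℚ.* ℚ.∣ S J ℚ.- S n ∣          ≡⟨ cong (λ z → P p J ℚ.* ℚ.∣ S m ℚ.- S J ∣ ℚ.+ P p J ℚ.* z) (∣-∣-comm (S J) (S n)) ⟩
        P p J ℚ.* ℚ.∣ S m ℚ.- S J ∣ ℚ.+ P p J ℚ.* ℚ.∣ S n ℚ.- S J ∣          ≤⟨ ℚ.+-mono-≤ (tail m J≤m) (tail n J≤n) ⟩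
        2ℚ                                                                   <⟨ ℚ.+-monoˡ-< 2ℚ (ℚ.positive⁻¹ 1ℚ) ⟩
        1ℚ ℚ.+ 2ℚ                                                            ≤⟨ arch J ℕ.≤-refl ⟩
        ε ℚ.* P p J                                                          ≡⟨ ℚ.*-comm ε (P p J) ⟩
        P p J ℚ.* ε                                                          ∎)
      where
      open ℚ.≤-Reasoning
      S = digitSum p a
      tail : ∀ m → J ℕ.≤ m → P p J ℚ.* ℚ.∣ S m ℚ.- S J ∣ ℚ.≤ 1ℚ
      tail m J≤m = subst (λ m → P p J ℚ.* ℚ.∣ S m ℚ.- S J ∣ ℚ.≤ 1ℚ) (ℕ.m+[n∸m]≡n J≤m) (digitSum-tail a J (m ℕ.∸ J))

    fromDigits : (ℕ → Fin p) → ℝ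
    fromDigits a = mkℝ (digitSum p a) (digitSum-cauchy a)

    fromDigits-expansion : ∀ a → IsExpansion p a (fromDigits a)
    fromDigits-expansion a ε 0<ε =
      let N , h = digitSum-cauchy a (½ ℚ.* ε) (half ε 0<ε) in
      N , λ n N≤n → ½ ℚ.* ε , half ε 0<ε , N , λ m N≤m →
        subst (ℚ.∣ digitSum p a n ℚ.- digitSum p a m ∣ ℚ.+ ½ ℚ.* ε ℚ.≤_) (half+half ε)
          (ℚ.+-monoˡ-≤ (½ ℚ.* ε) (ℚ.<⇒≤ (h n m N≤n N≤m)))

    0≤fromDigits : ∀ a → 0ℝ ≤ fromDigits a
    0≤fromDigits a ε 0<ε = 0 , λ n _ → ℚ.≤-trans (digitSum≥0 a n) (ℚ.<⇒≤ (p<p+q (digitSum p a n) 0<ε))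

    fromDigits≤1 : ∀ a → fromDigits a ≤ 1ℝ
    fromDigits≤1 a ε 0<ε = 0 , λ n _ → ℚ.≤-trans (digitSum≤1 a n) (ℚ.<⇒≤ (p<p+q 1ℚ 0<ε))

    -- Transfer of the lower bound to the limit word

    BoundedBelowFrom : ℚ → ℕ → ℝ → Set
    BoundedBelowFrom c N x = ∀ q → N ℕ.< q → Eventually λ k → c ℚ.≤ κ p q ℚ.* ‖ ι (+ q) ℚ.* seq x k ‖ℚ

    -- The exceptions `q ≤ N` disappear, because `q * p ^ n ≥ p ^ n > n ≥ N` for every `q ≥ 1`.
    scaled-bound : ∀ {c x N} → BoundedBelowFrom c N x → ∀ q → 1 ℕ.≤ q → ∀ n → N ℕ.≤ n →
      Eventually λ k → c ℚ.≤ κ p q ℚ.* ‖ ι (+ q) ℚ.* (P p n ℚ.* seq x k) ‖ℚ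
    scaled-bound {c} {x} {N} bound q@(suc _) (s≤s _) n N≤n
      with K , h ← bound (q ℕ.* p ℕ.^ n) (ℕ.≤-<-trans N≤n (ℕ.<-≤-trans (n<p^n p 1<p n) (ℕ.m≤n*m (p ℕ.^ n) q)))
      = K , λ k K≤k → subst₂ (λ y z → c ℚ.≤ y ℚ.* ‖ z ‖ℚ) (κ-*^ p 1<p q n)
          (trans (cong (ℚ._* seq x k) (ιℕ-* q (p ℕ.^ n))) (ℚ.*-assoc (ι (+ q)) (P p n) (seq x k)))
          (h k K≤k)

    -- The digits up to j are within 2 p⁻ʲ of some pⁿx modulo 1, and κ (q pⁿ) = κ q,
    -- so q inherits the bound for x at q pⁿ with an error O(p⁻ʲ).
    prefix-bound : ∀ {c x N} → BoundedBelowFrom c N x → ∀ a →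
      (∀ j → ShiftLanguage p x N (applyUpTo a j)) → ∀ q → 1 ℕ.≤ q → ∀ e → 0ℚ ℚ.< e →
      Eventually λ j → c ℚ.≤ e ℚ.+ κ p q ℚ.* ‖ ι (+ q) ℚ.* digitSum p a j ‖ℚ
    prefix-bound {c} {x} {N} bound a prefixes q 1≤q e 0<e =
      -- `J` depends on `q` and `e` only. The shift `n` changes with `j`, but neither `c` nor the
      -- error bound `2 q (κ p q) p⁻ʲ` depends on it.
      let J , arch = archimedean p 1<p ((κ p q ℚ.* ι (+ q)) ℚ.* 2ℚ) 0<e in
      J , λ j J≤j →
        let n , N≤n , m , K , near = prefixes j
            K′ , lower = scaled-bound {c} {x} {N} bound q 1≤q n N≤n
        in transfer j (arch j J≤j) n m (seq x (K ℕ.⊔ K′))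
             (near (K ℕ.⊔ K′) (ℕ.m≤m⊔n K K′)) (lower (K ℕ.⊔ K′) (ℕ.m≤n⊔m K K′))
      where
      open ℚ.≤-Reasoning
      open +-*-Solver
      Q = ι (+ q)
      r = κ p q ℚ.* Q
      r-nonNeg : ℚ.NonNegative r
      r-nonNeg = ℚ.nonNeg*nonNeg⇒nonNeg (κ p q) {{κ-nonNeg p q}} Q {{ιℕ-nonNeg q}}
      swap : ∀ a b c → a ℚ.* (b ℚ.* c) ≡ b ℚ.* (a ℚ.* c)
      swap = solve 3 (λ a b c → a :* (b :* c) := b :* (a :* c)) refl
      distrib : ∀ k Q d t → k ℚ.* (Q ℚ.* d ℚ.+ t) ≡ (k ℚ.* Q) ℚ.* d ℚ.+ k ℚ.* t
      distrib = solve 4 (λ k Q d t → k :* (Q :* d :+ t) := (k :* Q) :* d :+ k :* t) refl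
      expand : ∀ j n s m D → j ℚ.* (n ℚ.* s ℚ.- m ℚ.- D) ≡ (n ℚ.* j) ℚ.* s ℚ.- (m ℚ.* j ℚ.+ j ℚ.* D)
      expand = solve 5 (λ j n s m D → j :* (n :* s :- m :- D) := (n :* j) :* s :- (m :* j :+ j :* D)) refl
      module _ (j : ℕ) (arch : r ℚ.* 2ℚ ℚ.≤ e ℚ.* P p j) (n : ℕ) (m : ℤ) (t : ℚ) where
        s = P p n ℚ.* t
        D = digitSum p a j
        u = applyUpTo a j
        E = s ℚ.- ι m ℚ.- D
        F = P p (n ℕ.+ length u) ℚ.* t ℚ.- ι (m ℤ.* + (p ℕ.^ length u) ℤ.+ + value p u)
        transfer : ℚ.∣ F ∣ ℚ.≤ 2ℚ → c ℚ.≤ κ p q ℚ.* ‖ Q ℚ.* s ‖ℚ →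
          c ℚ.≤ e ℚ.+ κ p q ℚ.* ‖ Q ℚ.* D ‖ℚ
        transfer near lower = begin
          c                                                       ≤⟨ lower ⟩
          κ p q ℚ.* ‖ Q ℚ.* s ‖ℚ                                  ≤⟨ ℚ.*-monoˡ-≤-nonNeg (κ p q) {{κ-nonNeg p q}} (‖‖ℚ-shift q m s D) ⟩
          κ p q ℚ.* (Q ℚ.* ℚ.∣ E ∣ ℚ.+ ‖ Q ℚ.* D ‖ℚ)              ≡⟨ distrib (κ p q) Q ℚ.∣ E ∣ ‖ Q ℚ.* D ‖ℚ ⟩
          r ℚ.* ℚ.∣ E ∣ ℚ.+ κ p q ℚ.* ‖ Q ℚ.* D ‖ℚ                ≤⟨ ℚ.+-monoˡ-≤ (κ p q ℚ.* ‖ Q ℚ.* D ‖ℚ) error ⟩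
          e ℚ.+ κ p q ℚ.* ‖ Q ℚ.* D ‖ℚ                            ∎
          where
          scaled : P p j ℚ.* E ≡ P p (n ℕ.+ length u) ℚ.* t ℚ.- ι (m ℤ.* + (p ℕ.^ length u) ℤ.+ + value p u)
          scaled = begin-equality
            P p j ℚ.* E                                              ≡⟨ expand (P p j) (P p n) t (ι m) D ⟩
            (P p n ℚ.* P p j) ℚ.* t ℚ.- (ι m ℚ.* P p j ℚ.+ P p j ℚ.* D)
              ≡⟨ cong₂ (λ y z → y ℚ.* t ℚ.- (ι m ℚ.* P p j ℚ.+ z)) (sym (P-+ p n j)) (P*digitSum p a j) ⟩
            P p (n ℕ.+ j) ℚ.* t ℚ.- (ι m ℚ.* P p j ℚ.+ ι (+ value p u))
              ≡⟨ cong (λ z → P p (n ℕ.+ j) ℚ.* t ℚ.- z)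
                   (trans (cong (ℚ._+ ι (+ value p u)) (sym (ι-* m (+ (p ℕ.^ j))))) (sym (ι-+ (m ℤ.* + (p ℕ.^ j)) (+ value p u)))) ⟩
            P p (n ℕ.+ j) ℚ.* t ℚ.- ι (m ℤ.* + (p ℕ.^ j) ℤ.+ + value p u)
              ≡⟨ cong (λ l → P p (n ℕ.+ l) ℚ.* t ℚ.- ι (m ℤ.* + (p ℕ.^ l) ℤ.+ + value p u)) (sym (List.length-applyUpTo a j)) ⟩
            P p (n ℕ.+ length u) ℚ.* t ℚ.- ι (m ℤ.* + (p ℕ.^ length u) ℤ.+ + value p u) ∎
          error : r ℚ.* ℚ.∣ E ∣ ℚ.≤ e
          error = ℚ.*-cancelˡ-≤-pos (P p j) {{P-pos p j}} (begin
            P p j ℚ.* (r ℚ.* ℚ.∣ E ∣)     ≡⟨ swap (P p j) r ℚ.∣ E ∣ ⟩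
            r ℚ.* (P p j ℚ.* ℚ.∣ E ∣)     ≡⟨ cong (r ℚ.*_) (∣∣-* (P p j) E {{P-nonNeg p j}}) ⟨
            r ℚ.* ℚ.∣ P p j ℚ.* E ∣       ≡⟨ cong (λ z → r ℚ.* ℚ.∣ z ∣) scaled ⟩
            r ℚ.* ℚ.∣ F ∣                 ≤⟨ ℚ.*-monoˡ-≤-nonNeg r {{r-nonNeg}} near ⟩
            r ℚ.* 2ℚ                      ≤⟨ arch ⟩
            e ℚ.* P p j                   ≡⟨ ℚ.*-comm e (P p j) ⟩
            P p j ℚ.* e                   ∎)

    -- The digit sums are the approximating sequence of `fromDigits a`, so `prefix-bound` with `e`
    -- equal to half of `c` leaves the other half as a lower bound for every `q ≥ 1`.
    prefixes⇒counterexample : ∀ {c x N} → 0ℚ ℚ.< c → BoundedBelowFrom c N x → ∀ a →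
      (∀ j → ShiftLanguage p x N (applyUpTo a j)) → Counterexample p (fromDigits a)
    prefixes⇒counterexample {c} {x} {N} 0<c bound a prefixes =
      bounded⇒liminf≢0 (pLC-sequence p (fromDigits a)) (half c 0<c) (0 , λ n _ →
        let J , h = prefix-bound {c} {x} {N} bound a prefixes (suc n) (s≤s z≤n) (½ ℚ.* c) (half c 0<c) in
        J , λ j J≤j → cancel (κ p (suc n) ℚ.* ‖ ι (+ suc n) ℚ.* digitSum p a j ‖ℚ) (h j J≤j))
      where
      open +-*-Solver
      minus-half : ∀ c → c ℚ.- ½ ℚ.* c ≡ ½ ℚ.* c
      minus-half = solve 1 (λ c → c :- con ½ :* c := con ½ :* c) refl
      cancel : ∀ t → c ℚ.≤ ½ ℚ.* c ℚ.+ t → ½ ℚ.* c ℚ.≤ t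
      cancel t h = subst (ℚ._≤ t) (minus-half c)
        (≤+⇒-≤ {c} {t} {½ ℚ.* c} (subst (c ℚ.≤_) (ℚ.+-comm (½ ℚ.* c) t) h))

    recurrent-counterexample : ExcludedMiddle 0ℓ → ∀ {c x N} → 0ℚ ℚ.< c → BoundedBelowFrom c N x →
      ∃ λ a → Counterexample p (fromDigits a) × UniformlyRecurrent a
    recurrent-counterexample em {c} {x} {N} 0<c bound =
      limit , prefixes⇒counterexample {c} {x} {N} 0<c bound limit prefix∈L , limit-recurrent
      where
      open Words.Minimal p em (ShiftLanguage p x N) (shiftLanguage-closed p x N) (shiftLanguage-unbounded p x N)

theorem2p6 : ExcludedMiddle 0ℓ →
    (p : ℕ) .{{_ : NonZero p}} → Prime p →
    (∃ λ (x : ℝ) → Counterexample p x) →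
    ∃ λ (x : ℝ) → 0ℝ ≤ x × x ≤ 1ℝ × Counterexample p x ×
    (∃ λ (a : ℕ → Fin p) → IsExpansion p a x × UniformlyRecurrent a)
theorem2p6 em p p-prime (x , ¬plc) =
  let c , 0<c , N , bound = liminf≢0⇒bounded (pLC-sequence p x) em (pLC-sequence-nonNeg p x) ¬plc
      a , counterexample , recurrent = recurrent-counterexample p 1<p em {c} {x} {N} 0<c
        -- The term of index `n` belongs to `q = suc n`, so `N ≤ n` turns into `N < q`.
        λ { (suc n) (s≤s N≤n) → bound n N≤n }
  in fromDigits p 1<p a , 0≤fromDigits p 1<p a , fromDigits≤1 p 1<p a , counterexample ,
     a , fromDigits-expansion p 1<p a , recurrent
  where
  1<p : 1 ℕ.< p
  1<p = ℕ.nonTrivial⇒n>1 p {{prime⇒nonTrivial p-prime}}
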